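{- Fix an integer $d\ge 2$. There is a function $f_d:\mathbb{N}\to\mathbb{R}$ with $f_d(w)\to 0$ as $w\to\infty$ such that for every positive integer $w$, \[ \mathrm{olw}_R(w,d)\;\ge\;\Big(2-\frac{1}{d-1}-f_d(w)\Big)\binom{w+1}{2}. \] In words: no on-line algorithm partitions $d$-dimensional posets of width $w$, presented on-line via a realizer of cardinality $d$, into fewer than $(2-\frac{1}{d-1}-o(1))\binom{w+1}{2}$ chains.
   Context: On-line chain partitioning is a game between two players, Anna and Bertha. In each round Anna introduces a new point and Bertha irrevocably assigns it to a chain, equivalently gives it a color, so that each color class is a chain of the final poset. In the variant with a presented realizer of cardinality $d$, Anna maintains $d$ linear orders $L_1,\dots,L_d$ on the points introduced so far. In each round she inserts the new point into each $L_j$ and reveals all $d$ linear orders to Bertha. The poset presented is $P=L_1\cap\cdots\cap L_d$, and earlier relative positions never change. $\mathrm{olw}_R(w,d)$ is the largest integer $k$ such that Anna has a strategy of this kind forcing every on-line chain partitioning algorithm to use at least $k$ chains on a poset of width at most $w$. -}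

module Defs where

open import Data.Nat as ℕ using (ℕ; zero; suc; _⊔_)
open import Data.Fin as Fin using (Fin; zero; suc; toℕ; punchIn)
open import Data.Integer using (+_)
open import Data.Rational as ℚ using (ℚ; _/_; 0ℚ)
open import Data.Product using (Σ; _×_)
open import Data.Sum using (_⊎_)
open import Relation.Binary.PropositionalEquality using (_≡_; _≢_)
open import Function.Definitions using (Injective)

-- A state of the game after n rounds, for a realizer of cardinality d:
--   rank j x : position of point x in the linear order L_j (an injection
--   Fin n → Fin n by construction, built up by successive insertions),
--   the poset is P = L_1 ∩ … ∩ L_d.

_≤[_]_ : ∀ {d n} → Fin n → (Fin d → Fin n → Fin n) → Fin n → Set
x ≤[ rank ] y = ∀ j → rank j x Fin.≤ rank j y

Comparable : ∀ {d n} → (Fin d → Fin n → Fin n) → Fin n → Fin n → Set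
Comparable rank x y = (x ≤[ rank ] y) ⊎ (y ≤[ rank ] x)

WidthAtMost : ∀ {d n} → ℕ → (Fin d → Fin n → Fin n) → Set
WidthAtMost {n = n} w rank =
  (a : Fin (suc w) → Fin n) → Injective _≡_ _≡_ a →
  Σ (Fin (suc w)) λ i → Σ (Fin (suc w)) λ j → i ≢ j × Comparable rank (a i) (a j)

insert : ∀ {d n} → (Fin d → Fin n → Fin n) → (Fin d → Fin (suc n)) →
         Fin d → Fin (suc n) → Fin (suc n)
insert rank p j zero    = p j
insert rank p j (suc x) = punchIn (p j) (rank j x)

-- Colours: after some rounds, m chains have been opened, named 0 … m-1,
-- and colour x < m.  Bertha puts the new point into chain b : Fin (suc m),
-- where b = m means opening a new chain.
recolour : ∀ {n} → (Fin n → ℕ) → ℕ → Fin (suc n) → ℕ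
recolour c b zero    = b
recolour c b (suc x) = c x

-- Bertha's choice is legal iff the colour class stays a chain: the new point
-- is comparable (in the new poset) to every old point of the same colour.
LegalColour : ∀ {d n} → (Fin d → Fin (suc n) → Fin (suc n)) → (Fin n → ℕ) → ℕ → Set
LegalColour {n = n} rank c b = (x : Fin n) → c x ≡ b → Comparable rank zero (suc x)

-- AnnaForces d w k rank c : from the position (n points with realizer rank,
-- m chains used, colouring c) Anna has a strategy that, against every
-- on-line chain partitioning algorithm, presents a poset of width ≤ w via a
-- realizer of cardinality d and ends with at least k chains used.
-- (Inductive: every play is finite.)
data AnnaForces (d w k : ℕ) : (n m : ℕ) → (Fin d → Fin n → Fin n) → (Fin n → ℕ) → Set where
  done : ∀ {n m rank c} → k ℕ.≤ m → AnnaForces d w k n m rank c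
  move : ∀ {n m rank c} → (p : Fin d → Fin (suc n)) →
         WidthAtMost w (insert rank p) →
         ((b : Fin (suc m)) → LegalColour (insert rank p) c (toℕ b) →
            AnnaForces d w k (suc n) (suc (toℕ b) ⊔ m) (insert rank p) (recolour c (toℕ b))) →
         AnnaForces d w k n m rank c

OlwR≥ : (w d k : ℕ) → Set
OlwR≥ w d k = AnnaForces d w k 0 0 (λ _ ()) (λ ())

-- 1/n as a rational (junk value 0 at n = 0; only used with n ≥ 1)
oneOver : ℕ → ℚ
oneOver zero    = 0ℚ
oneOver (suc n) = + 1 / suc n

ℕ→ℚ : ℕ → ℚ
ℕ→ℚ n = + n / 1

{-# OPTIONS --safe #-}
module Submission where

-- Szemerédi's argument, with a better reward per unit of width.  If C is a chain on top of one
-- order L_a, then points placed just below C in L_a and on top of the other orders are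
-- incomparable to C and above everything else, so they use new colours and have width one less
-- to themselves.
--
-- A chain with n colours on top of L_a is forced in width n as follows.  Keep a chain C′ on top of
-- some L_b with b ≠ a, and beside it force C″ on top of L_a with n - 1 colours.  Put a point z above
-- everything.  Either its colour is not in C″, and C″ ∪ {z} is as wanted, or it is not in C′, and
-- C′ ∪ {z} replaces C′.  The latter cannot go on once C′ has all the colours to be forced in total.
--
-- With e = d - 1 and width n + e, force pairwise incomparable chains C_1, …, C_e with n colours,
-- C_i on top of L_i, and then above them, by the same argument upside down, a chain Z with n
-- colours at the bottom of L_0.  The C_i have disjoint colours, so some C_i shares at most n / e
-- colours with Z.  Go on playing beside this C_i and beside Z, above the rest of what lies below Z
-- and below the rest of what lies above: C_i ∪ Z is a chain, so one unit of width has paid for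
-- 2n - n / e colours.

open import Defs
open import Data.Nat using (ℕ; _≤_; _∸_; _+_)
open import Data.Nat.Combinatorics using (_C_)
open import Data.Rational using (ℚ; _<_; 0ℚ; _-_; _*_) renaming (_≤_ to _≤ℚ_)
open import Data.Product using (Σ; _×_)
open import Level using (0ℓ)
open import Data.Nat using (zero; suc; z≤n; s≤s; _⊔_; _/_; NonZero)
import Data.Nat as ℕ
import Data.Nat.Properties as ℕ
import Data.Nat.DivMod as ℕ
open import Data.Nat.Combinatorics using (nCk+nC[k+1]≡[n+1]C[k+1]; nC1≡n)
open import Data.Nat.ListAction using (sum)
open import Data.Nat.Solver using (module +-*-Solver)
open import Data.Integer using (+_; +[1+_])
import Data.Integer as ℤ
import Data.Integer.Properties as ℤ
import Data.Integer.Solver as ℤ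
open import Data.Rational using (mkℚ; 1ℚ; toℚᵘ; *<*)
import Data.Rational as ℚ
import Data.Rational.Properties as ℚ
open import Data.Rational.Unnormalised using (mkℚᵘ; *≤*)
import Data.Rational.Unnormalised as ℚᵘ
import Data.Rational.Unnormalised.Properties as ℚᵘ
open import Data.Fin using (Fin; zero; suc; toℕ; fromℕ<; punchIn)
import Data.Fin.Properties as Fin
open import Data.Product using (∃; ∃₂; _,_; proj₁; proj₂)
open import Data.Sum using (_⊎_; inj₁; inj₂; swap; [_,_]′)
open import Data.List using (List; []; _∷_; _++_; length; lookup; map; tabulate; filter; concat; allFin)
import Data.List.Properties as List
open import Data.List.Membership.Propositional using (_∈_; _∉_)
open import Data.List.Membership.DecPropositional ℕ._≟_ using (_∈?_)
open import Data.List.Membership.Propositional.Properties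
  using (∈-lookup; ∈-map⁻; ∈-map⁺; ∈-++⁻; ∈-++⁺ˡ; ∈-++⁺ʳ; ∈-filter⁻; ∈-concat⁺′)
open import Data.List.Relation.Unary.Unique.Propositional using (Unique)
import Data.List.Relation.Unary.Unique.Propositional.Properties as Unique
open import Data.List.Relation.Binary.Subset.Propositional using (_⊆_)
open import Data.List.Relation.Unary.All as All using (All; []; _∷_)
import Data.List.Relation.Unary.All.Properties as All
open import Data.List.Relation.Unary.AllPairs using (AllPairs; []; _∷_)
import Data.List.Relation.Unary.AllPairs.Properties as AllPairs
open import Data.List.Relation.Unary.Any using (here; there; index)
import Data.List.Relation.Unary.Any.Properties as Any
open import Relation.Binary using (Rel; Symmetric; Reflexive)
open import Relation.Binary.PropositionalEquality
open import Relation.Nullary using (¬_; contradiction; Dec; yes; no)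
open import Relation.Nullary.Decidable using (decidable-stable; _⊎-dec_; _×-dec_; ¬?)
open import Relation.Unary using (Decidable)
open import Function using (_∘_)

-- Antichains in concatenated lists

-- Serves to cut an antichain of `L′ ++ L` into its parts in `L′` and in `L`, while remembering that
-- points of different parts are incomparable.
split-AllPairs : ∀ {A : Set} {R : Rel A 0ℓ} {P Q : A → Set} → Symmetric R →
  ∀ {xs} → All (λ x → P x ⊎ Q x) xs → AllPairs R xs →
  ∃₂ λ ys zs → length xs ≡ length ys + length zs ×
    (ys ⊆ xs × zs ⊆ xs) × (All P ys × All Q zs) ×
    (AllPairs R ys × AllPairs R zs) × (∀ {y z} → y ∈ ys → z ∈ zs → R y z)
split-AllPairs R-sym [] [] =
  [] , [] , refl , ((λ ()) , λ ()) , ([] , []) , ([] , []) , λ ()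
split-AllPairs R-sym (p ∷ ps) (r ∷ rs) with split-AllPairs R-sym ps rs
split-AllPairs R-sym {x ∷ _} (inj₁ p ∷ _) (r ∷ _)
  | ys , zs , eq , (ys⊆ , zs⊆) , (pys , qzs) , (rys , rzs) , cross =
    x ∷ ys , zs , cong suc eq ,
    ((λ { (here e) → here e ; (there i) → there (ys⊆ i) }) , there ∘ zs⊆) ,
    (p ∷ pys , qzs) ,
    (All.tabulate (All.lookup r ∘ ys⊆) ∷ rys , rzs) ,
    λ { (here refl) j → All.lookup r (zs⊆ j) ; (there i) j → cross i j }
split-AllPairs R-sym {x ∷ _} (inj₂ q ∷ _) (r ∷ _)
  | ys , zs , eq , (ys⊆ , zs⊆) , (pys , qzs) , (rys , rzs) , cross =
    ys , x ∷ zs , trans (cong suc eq) (sym (ℕ.+-suc _ _)) ,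
    (there ∘ ys⊆ , (λ { (here e) → here e ; (there i) → there (zs⊆ i) })) ,
    (pys , q ∷ qzs) ,
    (rys , All.tabulate (All.lookup r ∘ zs⊆) ∷ rzs) ,
    λ { i (here refl) → R-sym (All.lookup r (ys⊆ i)) ; i (there j) → cross i j }

module Antichains {A : Set} (_~_ : Rel A 0ℓ)
  (~-refl : Reflexive _~_) (~-sym : Symmetric _~_) where

  -- Antichains are lists rather than sets: by reflexivity of `~`, pairwise incomparable entries are
  -- automatically distinct.
  Width : ℕ → List A → Set
  Width k L = ∀ xs → All (_∈ L) xs → AllPairs (λ x y → ¬ x ~ y) xs → length xs ≤ k

  Width-mono : ∀ {k l L} → k ≤ l → Width k L → Width l L
  Width-mono k≤l W xs xs∈L anti = ℕ.≤-trans (W xs xs∈L anti) k≤l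

  Width-[] : Width 0 []
  Width-[] [] _ _ = z≤n
  Width-[] (_ ∷ _) (() ∷ _) _

  Width-[-] : ∀ x → Width 1 (x ∷ [])
  Width-[-] x [] _ _ = z≤n
  Width-[-] x (_ ∷ []) _ _ = ℕ.≤-refl
  Width-[-] x (_ ∷ _ ∷ _) (here refl ∷ here refl ∷ _) ((x≁x ∷ _) ∷ _) = contradiction ~-refl x≁x

  -- An antichain that meets L′ meets L only in C.
  Width-++ : ∀ {k k′ t L L′} C → Width k L → Width k′ L′ → Width t C → t + k′ ≤ k →
    (∀ {x} → x ∈ L → x ∈ C ⊎ (∀ {y} → y ∈ L′ → y ~ x)) → Width k (L′ ++ L)
  Width-++ {L = L} {L′} C WL WL′ WC t+k′≤k meet xs xs∈ anti
    with split-AllPairs (λ x≁y → x≁y ∘ ~-sym) (All.map (∈-++⁻ L′) xs∈) anti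
  ... | [] , zs , eq , _ , (_ , zs∈L) , (_ , zs-anti) , _ =
    subst (_≤ _) (sym eq) (WL zs zs∈L zs-anti)
  ... | ys@(y ∷ _) , zs , eq , _ , (ys∈L′@(y∈L′ ∷ _) , zs∈L) , (ys-anti , zs-anti) , cross =
    ℕ.≤-trans (ℕ.≤-reflexive (trans eq (ℕ.+-comm (length ys) _)))
      (ℕ.≤-trans (ℕ.+-mono-≤ (WC zs (All.tabulate zs∈C) zs-anti) (WL′ ys ys∈L′ ys-anti)) t+k′≤k)
    where
    zs∈C : ∀ {z} → z ∈ zs → z ∈ C
    zs∈C z∈zs with meet (All.lookup zs∈L z∈zs)
    ... | inj₁ z∈C = z∈C
    ... | inj₂ above = contradiction (above y∈L′) (cross (here refl) z∈zs)

  Width-++-comparable : ∀ {k k′ L L′} → Width k L → Width k′ L′ → k′ ≤ k →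
    (∀ {x} → x ∈ L → ∀ {y} → y ∈ L′ → y ~ x) → Width k (L′ ++ L)
  Width-++-comparable WL WL′ k′≤k comp =
    Width-++ [] WL WL′ Width-[] k′≤k (λ x∈L → inj₂ (comp x∈L))

-- Counting in disjoint classes

module _ {A : Set} {P : A → Set} (P? : Decidable P) where

  length-filter-∁ : ∀ xs → length (filter P? xs) + length (filter (λ x → ¬? (P? x)) xs) ≡ length xs
  length-filter-∁ [] = refl
  length-filter-∁ (x ∷ xs) with P? x
  ... | yes _ = cong suc (length-filter-∁ xs)
  ... | no _  = trans (ℕ.+-suc _ _) (cong suc (length-filter-∁ xs))

  filter-disjoint : ∀ {Q : A → Set} (Q? : Decidable Q) → (∀ {x} → P x → ¬ Q x) → ∀ xs →
    length (filter Q? xs) ≤ length (filter Q? (filter (λ x → ¬? (P? x)) xs))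
  filter-disjoint Q? dis [] = z≤n
  filter-disjoint Q? dis (x ∷ xs) with P? x
  ... | yes p with Q? x
  ...   | yes q = contradiction q (dis p)
  ...   | no _  = filter-disjoint Q? dis xs
  filter-disjoint Q? dis (x ∷ xs) | no _ with Q? x
  ...   | yes _ = s≤s (filter-disjoint Q? dis xs)
  ...   | no _  = filter-disjoint Q? dis xs

module _ {A I : Set} {P : I → A → Set} (P? : ∀ i → Decidable (P i)) where

  -- Entries in class `i` can be removed without affecting the later classes, and what is removed
  -- pays for the first summand. The classes will be the colours of pairwise incomparable chains, so
  -- that their overlaps with one further chain add up to at most its length.
  disjoint-counts : ∀ {is} → AllPairs (λ i j → ∀ {x} → P i x → ¬ P j x) is → ∀ xs →
    sum (map (λ i → length (filter (P? i) xs)) is) ≤ length xs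
  disjoint-counts [] xs = z≤n
  disjoint-counts {i ∷ is} (dis ∷ diss) xs = begin
    length (filter (P? i) xs) + sum (map (λ j → length (filter (P? j) xs)) is)
      ≤⟨ ℕ.+-monoʳ-≤ _ (ℕ.≤-trans (sum-mono dis) (disjoint-counts diss rest)) ⟩
    length (filter (P? i) xs) + length rest
      ≡⟨ length-filter-∁ (P? i) xs ⟩
    length xs ∎
    where
    open ℕ.≤-Reasoning
    rest = filter (λ x → ¬? (P? i x)) xs
    sum-mono : ∀ {js} → All (λ j → ∀ {x} → P i x → ¬ P j x) js →
      sum (map (λ j → length (filter (P? j) xs)) js) ≤ sum (map (λ j → length (filter (P? j) rest)) js)
    sum-mono [] = z≤n
    sum-mono {j ∷ _} (d ∷ ds) = ℕ.+-mono-≤ (filter-disjoint (P? i) (P? j) d xs) (sum-mono ds)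

min≤average : ∀ {I : Set} (f : I → ℕ) is → 1 ≤ length is →
  ∃ λ i → i ∈ is × length is ℕ.* f i ≤ sum (map f is)
min≤average f (i ∷ []) _ = i , here refl , ℕ.≤-refl
min≤average f (i ∷ is@(_ ∷ _)) _ with min≤average f is (s≤s z≤n)
... | j , j∈is , le with ℕ.≤-total (f i) (f j)
...   | inj₁ fi≤fj = i , here refl ,
  ℕ.+-monoʳ-≤ (f i) (ℕ.≤-trans (ℕ.*-monoʳ-≤ (length is) fi≤fj) le)
...   | inj₂ fj≤fi = j , there j∈is , ℕ.+-mono-≤ fj≤fi le

-- Insertion positions and distinct colours

punchIn-below : ∀ {n} (p : Fin (suc n)) (r : Fin n) → toℕ r ℕ.< toℕ p → toℕ (punchIn p r) ≤ toℕ p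
punchIn-below (suc p) zero    _         = z≤n
punchIn-below (suc p) (suc r) (s≤s r<p) = s≤s (punchIn-below p r r<p)

punchIn-above : ∀ {n} (p : Fin (suc n)) (r : Fin n) → toℕ p ≤ toℕ r → toℕ p ≤ toℕ (punchIn p r)
punchIn-above zero    r       _         = z≤n
punchIn-above (suc p) (suc r) (s≤s p≤r) = s≤s (punchIn-above p r p≤r)

punchIn-≥⁻ : ∀ {n} (p : Fin (suc n)) (r : Fin n) → toℕ p ≤ toℕ (punchIn p r) → toℕ p ≤ toℕ r
punchIn-≥⁻ zero    r       _         = z≤n
punchIn-≥⁻ (suc p) (suc r) (s≤s p≤r) = s≤s (punchIn-≥⁻ p r p≤r)

punchIn-≤⁻ : ∀ {n} (p : Fin (suc n)) (r : Fin n) → toℕ (punchIn p r) ≤ toℕ p → toℕ r ℕ.< toℕ p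
punchIn-≤⁻ (suc p) zero    _         = s≤s z≤n
punchIn-≤⁻ (suc p) (suc r) (s≤s r≤p) = s≤s (punchIn-≤⁻ p r r≤p)

-- With `P` the points below a new coordinate and `f` the ranks, `s` is the insertion position.
-- Attainment keeps `s` within range and shows that a point ranked below `s` is ranked no higher
-- than some point satisfying `P`.
least-strict-bound : ∀ {n} {P : Fin n → Set} → (∀ x → Dec (P x)) → (f : Fin n → ℕ) →
  Σ ℕ λ s → (∀ x → P x → f x ℕ.< s) × (s ≡ 0 ⊎ ∃ λ x → P x × s ≡ suc (f x))
least-strict-bound {zero} P? f = 0 , (λ ()) , inj₁ refl
least-strict-bound {suc n} {P} P? f with least-strict-bound (P? ∘ suc) (f ∘ suc)
... | s , bound , attained with P? zero
...   | no ¬p = s , (λ { zero p → contradiction p ¬p ; (suc x) → bound x }) , map-attained attained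
  where
  map-attained : s ≡ 0 ⊎ (∃ λ x → P (suc x) × s ≡ suc (f (suc x))) →
                 s ≡ 0 ⊎ (∃ λ x → P x × s ≡ suc (f x))
  map-attained (inj₁ s≡0) = inj₁ s≡0
  map-attained (inj₂ (x , p , s≡)) = inj₂ (suc x , p , s≡)
...   | yes p = suc (f zero) ⊔ s ,
  (λ { zero _ → ℕ.m≤m⊔n _ s ; (suc x) q → ℕ.≤-trans (bound x q) (ℕ.m≤n⊔m _ s) }) ,
  inj₂ (attained′ (ℕ.⊔-sel (suc (f zero)) s) attained)
  where
  attained′ : suc (f zero) ⊔ s ≡ suc (f zero) ⊎ suc (f zero) ⊔ s ≡ s →
              s ≡ 0 ⊎ (∃ λ x → P (suc x) × s ≡ suc (f (suc x))) →
              ∃ λ x → P x × suc (f zero) ⊔ s ≡ suc (f x)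
  attained′ (inj₁ eq) _ = zero , p , eq
  attained′ (inj₂ eq) (inj₁ refl) = zero , p , ℕ.⊔-identityʳ _
  attained′ (inj₂ eq) (inj₂ (x , q , s≡)) = suc x , q , trans eq s≡

lookup-injective : ∀ {A : Set} {xs : List A} → Unique xs → ∀ i j → lookup xs i ≡ lookup xs j → i ≡ j
lookup-injective (_ ∷ _)  zero    zero    _  = refl
lookup-injective (x ∷ _)  zero    (suc j) eq = contradiction eq (All.lookup x (∈-lookup j))
lookup-injective (x ∷ _)  (suc i) zero    eq = contradiction (sym eq) (All.lookup x (∈-lookup i))
lookup-injective (_ ∷ xs) (suc i) (suc j) eq = cong suc (lookup-injective xs i j eq)

unique-bounded : ∀ {m} (xs : List ℕ) → Unique xs → All (ℕ._< m) xs → length xs ≤ m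
unique-bounded {m} xs u xs<m = Fin.injective⇒≤ {f = f} f-injective
  where
  f : Fin (length xs) → Fin m
  f i = fromℕ< (All.lookup xs<m (∈-lookup {xs = xs} i))
  f-injective : ∀ {i j} → f i ≡ f j → i ≡ j
  f-injective eq = lookup-injective u _ _ (Fin.fromℕ<-injective _ _ _ _ eq)

-- Game positions as lists of points with rational coordinates

-- Points of the game carry a fixed rational coordinate in each linear order,
-- so the room left between earlier points is a box that never moves.
Point : ℕ → Set
Point d = (Fin d → ℚ) × ℕ

module Play (d w T : ℕ) where

  infixl 30 _⟨_⟩
  _⟨_⟩ : Point d → Fin d → ℚ
  x ⟨ j ⟩ = proj₁ x j

  _~_ : Point d → Point d → Set
  x ~ y = (∀ j → x ⟨ j ⟩ ℚ.≤ y ⟨ j ⟩) ⊎ (∀ j → y ⟨ j ⟩ ℚ.≤ x ⟨ j ⟩)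

  ~-refl : ∀ {x} → x ~ x
  ~-refl = inj₁ (λ _ → ℚ.≤-refl)

  ~-sym : ∀ {x y} → x ~ y → y ~ x
  ~-sym = swap

  open Antichains _~_ (λ {x} → ~-refl {x}) (λ {x} {y} → ~-sym {x} {y}) public

  colour : Point d → ℕ
  colour = proj₂

  Proper : List (Point d) → Set
  Proper s = ∀ {x y} → x ∈ s → y ∈ s → colour x ≡ colour y → x ~ y

  -- The newest point is the head of `s`, matching index `zero` in `insert` and `recolour`. `mono`
  -- and `cancel` make ranks and coordinates interchangeable, and `proper` records that Bertha's
  -- replies so far were legal.
  record Represents (s : List (Point d)) (m : ℕ) (rank : Fin d → Fin (length s) → Fin (length s))
                    (c : Fin (length s) → ℕ) : Set where
    field
      coloured : ∀ x → c x ≡ colour (lookup s x)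
      opened   : ∀ x → c x ℕ.< m
      mono     : ∀ j x y → toℕ (rank j x) ≤ toℕ (rank j y) → lookup s x ⟨ j ⟩ ℚ.≤ lookup s y ⟨ j ⟩
      cancel   : ∀ j x y → lookup s x ⟨ j ⟩ ℚ.≤ lookup s y ⟨ j ⟩ → toℕ (rank j x) ≤ toℕ (rank j y)
      proper   : Proper s

  Wins : List (Point d) → Set
  Wins s = ∀ {m rank c} → Represents s m rank c → AnnaForces d w T (length s) m rank c

  -- Bertha's obligation to keep colour classes chains reaches a strategy through this: incomparable
  -- points have different colours.
  wins-proper : ∀ {s} → (Proper s → Wins s) → Wins s
  wins-proper win rep = win (Represents.proper rep) rep

  wins-done : ∀ {s} U → U ⊆ s → Unique (map colour U) → T ≤ length U → Wins s
  wins-done {s} U U⊆s u T≤ {m} {c = c} rep =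
    done (ℕ.≤-trans T≤ (subst (_≤ m) (List.length-map colour U)
      (unique-bounded _ u (All.map⁺ (All.tabulate used)))))
    where
    open Represents rep
    used : ∀ {x} → x ∈ U → colour x ℕ.< m
    used x∈U = subst (λ y → colour y ℕ.< m) (sym (Any.lookup-index (U⊆s x∈U)))
      (subst (ℕ._< m) (coloured i) (opened i))
      where i = index (U⊆s x∈U)

  Fresh : (Fin d → ℚ) → List (Point d) → Set
  Fresh v s = ∀ {x} → x ∈ s → ∀ j → v j ≢ x ⟨ j ⟩

  -- Translates a move given by rational coordinates into insertion positions: in `L_j` the new
  -- point goes directly above the points whose coordinate is less than `v j`, and `Fresh` excludes
  -- ties.
  wins-move : ∀ {s} v → Fresh v s → (∀ b → Width w ((v , b) ∷ s)) →
              (∀ b → Wins ((v , b) ∷ s)) → Wins s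
  wins-move {s} v fresh width next {m} {rank} {c} rep = move p widthAtMost respond
    where
    open Represents rep

    below? : ∀ j x → Dec (lookup s x ⟨ j ⟩ ℚ.< v j)
    below? j x = lookup s x ⟨ j ⟩ ℚ.<? v j

    bound : ∀ j → _
    bound j = least-strict-bound (below? j) (toℕ ∘ rank j)

    bound≤n : ∀ j → proj₁ (bound j) ℕ.< suc (length s)
    bound≤n j with proj₂ (proj₂ (bound j))
    ... | inj₁ eq = subst (ℕ._< suc (length s)) (sym eq) (s≤s z≤n)
    ... | inj₂ (x , _ , eq) = subst (ℕ._< suc (length s)) (sym eq) (s≤s (Fin.toℕ<n (rank j x)))

    p : Fin d → Fin (suc (length s))
    p j = fromℕ< (bound≤n j)

    toℕ-p : ∀ j → toℕ (p j) ≡ proj₁ (bound j)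
    toℕ-p j = Fin.toℕ-fromℕ< (bound≤n j)

    below⁺ : ∀ j x → lookup s x ⟨ j ⟩ ℚ.< v j → toℕ (rank j x) ℕ.< toℕ (p j)
    below⁺ j x x<v = subst (toℕ (rank j x) ℕ.<_) (sym (toℕ-p j)) (proj₁ (proj₂ (bound j)) x x<v)

    below⁻ : ∀ j x → toℕ (rank j x) ℕ.< toℕ (p j) → lookup s x ⟨ j ⟩ ℚ.< v j
    below⁻ j x r<p with subst (toℕ (rank j x) ℕ.<_) (toℕ-p j) r<p | proj₂ (proj₂ (bound j))
    ... | r<b | inj₁ eq = contradiction (subst (toℕ (rank j x) ℕ.<_) eq r<b) λ ()
    -- The position is one more than the rank of `y`, so `x` is ranked no higher than `y`, whose
    -- coordinate is less than `v j`.
    ... | r<b | inj₂ (y , y<v , eq) =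
      ℚ.≤-<-trans (mono j x y (ℕ.≤-pred (subst (toℕ (rank j x) ℕ.<_) eq r<b))) y<v

    rank′ = insert rank p

    mono′ : ∀ b j x y → toℕ (rank′ j x) ≤ toℕ (rank′ j y) →
            lookup ((v , b) ∷ s) x ⟨ j ⟩ ℚ.≤ lookup ((v , b) ∷ s) y ⟨ j ⟩
    mono′ b j zero    zero    _ = ℚ.≤-refl
    mono′ b j zero    (suc y) le = ℚ.≮⇒≥ (λ y<v →
      ℕ.<⇒≱ (below⁺ j y y<v) (punchIn-≥⁻ (p j) (rank j y) le))
    mono′ b j (suc x) zero    le = ℚ.<⇒≤ (below⁻ j x (punchIn-≤⁻ (p j) (rank j x) le))
    mono′ b j (suc x) (suc y) le = mono j x y (Fin.punchIn-cancel-≤ (p j) _ _ le)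

    cancel′ : ∀ b j x y → lookup ((v , b) ∷ s) x ⟨ j ⟩ ℚ.≤ lookup ((v , b) ∷ s) y ⟨ j ⟩ →
              toℕ (rank′ j x) ≤ toℕ (rank′ j y)
    cancel′ b j zero    zero    _ = ℕ.≤-refl
    cancel′ b j zero    (suc y) le = punchIn-above (p j) _ (ℕ.≮⇒≥ (λ r<p →
      ℚ.<-irrefl refl (ℚ.≤-<-trans le (below⁻ j y r<p))))
    cancel′ b j (suc x) zero    le = punchIn-below (p j) _ (below⁺ j x (ℚ.≰⇒> (λ v≤x →
      fresh (∈-lookup x) j (ℚ.≤-antisym v≤x le))))
    cancel′ b j (suc x) (suc y) le = Fin.punchIn-mono-≤ (p j) _ _ (cancel j x y le)

    module _ (b : ℕ) (legal : LegalColour rank′ c b) where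

      legal-~ : ∀ {x} → x ∈ s → b ≡ colour x → (v , b) ~ x
      legal-~ {x} x∈s b≡ = subst ((v , b) ~_) (sym x≡)
        (comparable (legal i (trans (coloured i) (sym (trans b≡ (cong colour x≡))))))
        where
        i = index x∈s
        x≡ = Any.lookup-index x∈s
        comparable : Comparable rank′ zero (suc i) → (v , b) ~ lookup s i
        comparable (inj₁ le) = inj₁ (λ j → mono′ b j zero (suc i) (le j))
        comparable (inj₂ le) = inj₂ (λ j → mono′ b j (suc i) zero (le j))

      represents : Represents ((v , b) ∷ s) (suc b ⊔ m) rank′ (recolour c b)
      represents = record
        { coloured = λ { zero → refl ; (suc x) → coloured x }
        ; opened   = λ { zero → ℕ.m≤m⊔n (suc b) m ; (suc x) → ℕ.≤-trans (opened x) (ℕ.m≤n⊔m (suc b) m) }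
        ; mono     = mono′ b
        ; cancel   = cancel′ b
        ; proper   = λ { (here refl) (here refl) _  → ~-refl {v , b}
                       ; (here refl) (there j)   eq → legal-~ j eq
                       ; (there i)   (here refl) eq → swap (legal-~ i (sym eq))
                       ; (there i)   (there j)   eq → proper i j eq }
        }

    respond : ∀ b → LegalColour rank′ c (toℕ b) → _
    respond b legal = next (toℕ b) (represents (toℕ b) legal)

    -- Comparability ignores colours, so `0` stands in for the colour not yet chosen.
    comparable⁺ : ∀ x y → lookup ((v , 0) ∷ s) x ~ lookup ((v , 0) ∷ s) y → Comparable rank′ x y
    comparable⁺ x y (inj₁ le) = inj₁ (λ j → cancel′ 0 j x y (le j))
    comparable⁺ x y (inj₂ le) = inj₂ (λ j → cancel′ 0 j y x (le j))

    widthAtMost : WidthAtMost w rank′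
    -- `Width` only refutes the absence of a comparable pair; as the finite search is decidable,
    -- this yields a pair.
    widthAtMost a _ = decidable-stable
      (Fin.any? λ i → Fin.any? λ j → ¬? (i Fin.≟ j) ×-dec
        (Fin.all? (λ k → rank′ k (a i) Fin.≤? rank′ k (a j)) ⊎-dec
         Fin.all? (λ k → rank′ k (a j) Fin.≤? rank′ k (a i))))
      λ none → ℕ.1+n≰n (subst (_≤ w) (List.length-tabulate (lookup ((v , 0) ∷ s) ∘ a))
        (width 0 (tabulate (lookup ((v , 0) ∷ s) ∘ a))
          (All.tabulate⁺ (λ i → ∈-lookup (a i)))
          (AllPairs.tabulate⁺ {f = lookup ((v , 0) ∷ s) ∘ a} (λ {i} {j} i≢j comp →
            none (i , j , i≢j , comparable⁺ (a i) (a j) comp)))))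

  -- Forcing a chain of distinct colours on top of one order

  -- Abstract in the order so that it can be used with `<` and, upside down, with `>`. Here `≺⇒~` is
  -- the reason that points cost no width, and `crossing` the reason that they get different
  -- colours.
  module Climb (_≺_ : ℚ → ℚ → Set)
    (≺-trans  : ∀ {p q r} → p ≺ q → q ≺ r → p ≺ r)
    (≺-irrefl : ∀ {p} → ¬ p ≺ p)
    (≺-dense  : ∀ {p q} → p ≺ q → ∃ λ r → p ≺ r × r ≺ q)
    (≺⇒~      : ∀ x y → (∀ j → x ⟨ j ⟩ ≺ y ⟨ j ⟩) → x ~ y)
    (crossing : ∀ x y i j → x ⟨ i ⟩ ≺ y ⟨ i ⟩ → y ⟨ j ⟩ ≺ x ⟨ j ⟩ → ¬ x ~ y)
    where

    infixr 5 _⟫_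
    _⟫_ : ∀ {p q r} → p ≺ q → q ≺ r → p ≺ r
    _⟫_ = ≺-trans

    Corner : Set
    Corner = Fin d → ℚ

    InBox : Corner → Corner → Point d → Set
    InBox lo hi x = ∀ j → lo j ≺ x ⟨ j ⟩ × x ⟨ j ⟩ ≺ hi j

    Free : Corner → Corner → List (Point d) → Set
    Free lo hi s = ∀ {x} → x ∈ s → ∀ j → x ⟨ j ⟩ ≺ lo j ⊎ hi j ≺ x ⟨ j ⟩

    -- The width that may still be spent in the box, whatever is played there. A strategy for the
    -- box needs to know nothing else about the older points than this and `Free`.
    Budget : Corner → Corner → ℕ → List (Point d) → Set
    Budget lo hi k s = ∀ E → (∀ {x} → x ∈ E → InBox lo hi x) → Width k E → Width w (E ++ s)

    -- Later points go into the gap (g , g′) of every L_j, beside `chain` and above `below`.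
    record Slot (axis j : Fin d) (l h : ℚ) (chain below : List (Point d)) : Set where
      field
        g g′ t     : ℚ
        l≺g        : l ≺ g
        g≺g′       : g ≺ g′
        g′≺t       : g′ ≺ t
        t≺h        : t ≺ h
        below≺g    : ∀ {x} → x ∈ below → x ⟨ j ⟩ ≺ g
        chain≺t    : ∀ {x} → x ∈ chain → x ⟨ j ⟩ ≺ t
        g′≺chain   : axis ≡ j → ∀ {x} → x ∈ chain → g′ ≺ x ⟨ j ⟩
        chain≺g    : axis ≢ j → ∀ {x} → x ∈ chain → x ⟨ j ⟩ ≺ g

      below≺t : ∀ {x} → x ∈ below → x ⟨ j ⟩ ≺ t
      below≺t i = below≺g i ⟫ g≺g′ ⟫ g′≺t

    -- `E` is everything played in the box so far, and `chain` the part worth keeping, with no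
    -- repeated colour. Play beside `chain` continues in the gap from `g` to `g′`, and the room
    -- between `t` and `hi` allows a point above all of `E`.
    record Forced (axis : Fin d) (lo hi : Corner) (E : List (Point d)) : Set where
      field
        chain below  : List (Point d)
        chain⊆       : chain ⊆ E
        split        : ∀ {x} → x ∈ E → x ∈ chain ⊎ x ∈ below
        slot         : ∀ j → Slot axis j (lo j) (hi j) chain below
        lo≺          : ∀ {x} → x ∈ E → ∀ j → lo j ≺ x ⟨ j ⟩
        chain-width  : Width 1 chain
        chain-unique : Unique (map colour chain)

      g g′ t : Corner
      g  j = Slot.g  (slot j)
      g′ j = Slot.g′ (slot j)
      t  j = Slot.t  (slot j)

      ≺t : ∀ {x} → x ∈ E → ∀ j → x ⟨ j ⟩ ≺ t j
      ≺t i j = [ Slot.chain≺t (slot j) , Slot.below≺t (slot j) ]′ (split i)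

      inBox : ∀ {x} → x ∈ E → InBox lo hi x
      inBox i j = lo≺ i j , ≺t i j ⟫ Slot.t≺h (slot j)

      gap-free : ∀ {s} → Free lo hi s → Free g g′ (E ++ s)
      gap-free free i j with ∈-++⁻ E i
      ... | inj₂ i∈s = [ (λ x≺l → inj₁ (x≺l ⟫ Slot.l≺g (slot j)))
                       , (λ h≺x → inj₂ (Slot.g′≺t (slot j) ⟫ Slot.t≺h (slot j) ⟫ h≺x)) ]′ (free i∈s j)
      ... | inj₁ i∈E with split i∈E | axis Fin.≟ j
      ...   | inj₂ below | _      = inj₁ (Slot.below≺g (slot j) below)
      ...   | inj₁ chain | yes eq = inj₂ (Slot.g′≺chain (slot j) eq chain)
      ...   | inj₁ chain | no neq = inj₁ (Slot.chain≺g (slot j) neq chain)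

      gap⊆box : ∀ {x} → InBox g g′ x → InBox lo hi x
      gap⊆box x∈gap j = Slot.l≺g (slot j) ⟫ proj₁ (x∈gap j) ,
                        proj₂ (x∈gap j) ⟫ Slot.g′≺t (slot j) ⟫ Slot.t≺h (slot j)

      below~gap : ∀ {x y} → x ∈ below → InBox g g′ y → y ~ x
      below~gap {x} {y} x∈below y∈gap =
        ~-sym {x} {y} (≺⇒~ x y λ j → Slot.below≺g (slot j) x∈below ⟫ proj₁ (y∈gap j))

      chain≁gap : ∀ {x y j} → axis ≢ j → x ∈ chain → InBox g g′ y → ¬ y ~ x
      chain≁gap {x} {y} {j} axis≢j x∈chain y∈gap = crossing y x axis j
        (proj₂ (y∈gap axis) ⟫ Slot.g′≺chain (slot axis) refl x∈chain)
        (Slot.chain≺g (slot j) axis≢j x∈chain ⟫ proj₁ (y∈gap j))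

      -- Points of `below` are comparable to the whole gap, so an antichain that meets the gap has
      -- at most one point in `E`, and that one is from `chain`.
      gap-width : ∀ {k E′} → Width (suc k) E → (∀ {x} → x ∈ E′ → InBox g g′ x) → Width k E′ →
                  Width (suc k) (E′ ++ E)
      gap-width WE E′⊆gap WE′ = Width-++ chain WE WE′ chain-width ℕ.≤-refl λ {x} x∈E →
        [ inj₁ , (λ x∈below → inj₂ λ {y} y∈E′ → below~gap {x} {y} x∈below (E′⊆gap y∈E′)) ]′ (split x∈E)

      gap-budget : ∀ {k s} → Budget lo hi (suc k) s → Width (suc k) E → Budget g g′ k (E ++ s)
      gap-budget {s = s} budget WE E′ E′⊆gap WE′ = subst (Width w) (List.++-assoc E′ E s)
        (budget (E′ ++ E)
          (λ {x} i → [ (λ i′ → gap⊆box {x} (E′⊆gap i′)) , inBox ]′ (∈-++⁻ E′ i))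
          (gap-width WE E′⊆gap WE′))

    nothing-forced : ∀ axis {lo hi} → (∀ j → lo j ≺ hi j) → Forced axis lo hi []
    nothing-forced axis {lo} {hi} lo≺hi = record
      { chain = [] ; below = [] ; chain⊆ = λ () ; split = λ () ; slot = slot
      ; lo≺ = λ () ; chain-width = Width-mono z≤n Width-[] ; chain-unique = [] }
      where
      slot : ∀ j → Slot axis j (lo j) (hi j) [] []
      slot j with ≺-dense (lo≺hi j)
      ... | g , l≺g , g≺h with ≺-dense g≺h
      ... | g′ , g≺g′ , g′≺h with ≺-dense g′≺h
      ... | t , g′≺t , t≺h = record
        { l≺g = l≺g ; g≺g′ = g≺g′ ; g′≺t = g′≺t ; t≺h = t≺h
        ; below≺g = λ () ; chain≺t = λ () ; g′≺chain = λ _ () ; chain≺g = λ _ () }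

    -- Away from the axis the gap must clear all points, so it can start at any strict bound `z` of
    -- them.
    off-axis-slot : ∀ {axis j l h z chain below} → axis ≢ j → l ≺ z → z ≺ h →
      (∀ {x} → x ∈ below → x ⟨ j ⟩ ≺ z) → (∀ {x} → x ∈ chain → x ⟨ j ⟩ ≺ z) →
      Slot axis j l h chain below
    off-axis-slot axis≢j l≺z z≺h below≺z chain≺z with ≺-dense z≺h
    ... | g′ , z≺g′ , g′≺h with ≺-dense g′≺h
    ... | t , g′≺t , t≺h = record
      { l≺g = l≺z ; g≺g′ = z≺g′ ; g′≺t = g′≺t ; t≺h = t≺h
      ; below≺g = below≺z
      ; chain≺t = λ i → chain≺z i ⟫ z≺g′ ⟫ g′≺t
      ; g′≺chain = λ axis≡j → contradiction axis≡j axis≢j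
      ; chain≺g = λ _ → chain≺z }

    -- In continuation-passing form, since the points played depend on Bertha's replies: play goes
    -- on from whichever `E` results.
    Strategy : Fin d → ℕ → Set
    Strategy axis k = ∀ {s lo hi} → (∀ j → lo j ≺ hi j) → Free lo hi s → Budget lo hi k s →
      (∀ E (F : Forced axis lo hi E) → Width k E → length (Forced.chain F) ≡ k → Wins (E ++ s)) →
      Wins s

    -- F.chain is the chain C′ of the argument and F₁.chain is C″.
    module Round {a b} (a≢b : a ≢ b) {lo hi E E₁} (F : Forced b lo hi E)
      (F₁ : Forced a (Forced.g F) (Forced.g′ F) E₁) where

      module F = Forced F
      module F₁ = Forced F₁
      module S j = Slot (F.slot j)
      module S₁ j = Slot (F₁.slot j)

      -- `z` is the next point, above everything played so far in the box. `u`, between it and `hi`,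
      -- becomes the new `t` on the axis and the new `g` in the other orders.
      z u : Corner
      z j = proj₁ (≺-dense (S.t≺h j))
      u j = proj₁ (≺-dense (proj₂ (proj₂ (≺-dense (S.t≺h j)))))

      t≺z : ∀ j → F.t j ≺ z j
      t≺z j = proj₁ (proj₂ (≺-dense (S.t≺h j)))

      z≺u : ∀ j → z j ≺ u j
      z≺u j = proj₁ (proj₂ (≺-dense (proj₂ (proj₂ (≺-dense (S.t≺h j))))))

      u≺h : ∀ j → u j ≺ hi j
      u≺h j = proj₂ (proj₂ (≺-dense (proj₂ (proj₂ (≺-dense (S.t≺h j))))))

      t₁≺t : ∀ j → F₁.t j ≺ F.t j
      t₁≺t j = S₁.t≺h j ⟫ S.g′≺t j

      lo≺z : ∀ j → lo j ≺ z j
      lo≺z j = S.l≺g j ⟫ S.g≺g′ j ⟫ S.g′≺t j ⟫ t≺z j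

      older≺z : ∀ {x} → x ∈ E₁ ++ E → ∀ j → x ⟨ j ⟩ ≺ z j
      older≺z i j with ∈-++⁻ E₁ i
      ... | inj₁ i∈E₁ = F₁.≺t i∈E₁ j ⟫ t₁≺t j ⟫ t≺z j
      ... | inj₂ i∈E  = F.≺t i∈E j ⟫ t≺z j

      module _ (c : ℕ) where

        E′ : List (Point d)
        E′ = (z , c) ∷ E₁ ++ E

        E′≺u : ∀ {x} → x ∈ E′ → ∀ j → x ⟨ j ⟩ ≺ u j
        E′≺u (here refl) j = z≺u j
        E′≺u (there i)   j = older≺z i j ⟫ z≺u j

        lo≺E′ : ∀ {x} → x ∈ E′ → ∀ j → lo j ≺ x ⟨ j ⟩
        lo≺E′ (here refl) j = lo≺z j
        lo≺E′ (there i) j with ∈-++⁻ E₁ i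
        ... | inj₁ i∈E₁ = S.l≺g j ⟫ F₁.lo≺ i∈E₁ j
        ... | inj₂ i∈E  = F.lo≺ i∈E j

        Width-∷ : ∀ {k L} → 1 ≤ k → L ⊆ E₁ ++ E → Width k L → Width k ((z , c) ∷ L)
        Width-∷ 1≤k L⊆ WL = Width-++-comparable WL (Width-[-] (z , c)) 1≤k
          λ { {x} i (here refl) → ~-sym {x} {z , c} (≺⇒~ x (z , c) (older≺z (L⊆ i))) }

        fresh-colour : ∀ {L} → c ∉ map colour L → Unique (map colour L) → Unique (map colour ((z , c) ∷ L))
        fresh-colour c∉ u = All.tabulate (λ i c≡ → c∉ (subst (_∈ _) (sym c≡) i)) ∷ u

        -- The other chain is given up. It has axis `b`, so in `L_a` all of `E` lies below the box
        -- of `F₁`, and the gap of `F₁` in `L_a` can be kept.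
        extend-short : c ∉ map colour F₁.chain → Forced a lo hi E′
        extend-short c∉ = record
          { chain = (z , c) ∷ F₁.chain
          ; below = F₁.below ++ E
          ; chain⊆ = chain⊆
          ; split = split
          ; slot = slot
          ; lo≺ = lo≺E′
          ; chain-width = Width-∷ ℕ.≤-refl (∈-++⁺ˡ ∘ F₁.chain⊆) F₁.chain-width
          ; chain-unique = fresh-colour c∉ F₁.chain-unique
          }
          where
          chain⊆ : (z , c) ∷ F₁.chain ⊆ E′
          chain⊆ (here e) = here e
          chain⊆ (there i) = there (∈-++⁺ˡ (F₁.chain⊆ i))

          split : ∀ {x} → x ∈ E′ → x ∈ (z , c) ∷ F₁.chain ⊎ x ∈ F₁.below ++ E
          split (here e) = inj₁ (here e)
          split (there i) with ∈-++⁻ E₁ i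
          ... | inj₂ i∈E = inj₂ (∈-++⁺ʳ F₁.below i∈E)
          ... | inj₁ i∈E₁ = [ inj₁ ∘ there , inj₂ ∘ ∈-++⁺ˡ ]′ (F₁.split i∈E₁)

          slot : ∀ j → Slot a j (lo j) (hi j) ((z , c) ∷ F₁.chain) (F₁.below ++ E)
          slot j with a Fin.≟ j
          ... | no a≢j = off-axis-slot a≢j (lo≺z j ⟫ z≺u j) (u≺h j)
            (λ i → [ (λ i → S₁.below≺t j i ⟫ t₁≺t j ⟫ t≺z j ⟫ z≺u j)
                   , (λ i → F.≺t i j ⟫ t≺z j ⟫ z≺u j) ]′ (∈-++⁻ F₁.below i))
            (λ i → E′≺u (chain⊆ i) j)
          ... | yes refl = record
            { l≺g = S.l≺g a ⟫ S₁.l≺g a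
            ; g≺g′ = S₁.g≺g′ a
            ; g′≺t = S₁.g′≺t a ⟫ t₁≺t a ⟫ t≺z a ⟫ z≺u a
            ; t≺h = u≺h a
            ; below≺g = λ i → [ S₁.below≺g a , (λ i → E≺g (F.split i) ⟫ S₁.l≺g a) ]′ (∈-++⁻ F₁.below i)
            ; chain≺t = λ i → E′≺u (chain⊆ i) a
            ; g′≺chain = λ { _ (here refl) → S₁.g′≺t a ⟫ t₁≺t a ⟫ t≺z a
                           ; _ (there i) → S₁.g′≺chain a refl i }
            ; chain≺g = contradiction refl
            }
            where
            E≺g : ∀ {x} → x ∈ F.chain ⊎ x ∈ F.below → x ⟨ a ⟩ ≺ F.g a
            E≺g (inj₁ i) = S.chain≺g a (a≢b ∘ sym) i
            E≺g (inj₂ i) = S.below≺g a i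

        -- `F₁.chain` is given up and all of `E₁` counts as `below`. In `L_b` the new gap runs from
        -- `F₁.t` to the old `F.g′`, above `E₁` and still below the chain.
        extend-long : c ∉ map colour F.chain → Forced b lo hi E′
        extend-long c∉ = record
          { chain = (z , c) ∷ F.chain
          ; below = E₁ ++ F.below
          ; chain⊆ = chain⊆
          ; split = split
          ; slot = slot
          ; lo≺ = lo≺E′
          ; chain-width = Width-∷ ℕ.≤-refl (∈-++⁺ʳ E₁ ∘ F.chain⊆) F.chain-width
          ; chain-unique = fresh-colour c∉ F.chain-unique
          }
          where
          chain⊆ : (z , c) ∷ F.chain ⊆ E′
          chain⊆ (here e) = here e
          chain⊆ (there i) = there (∈-++⁺ʳ E₁ (F.chain⊆ i))

          split : ∀ {x} → x ∈ E′ → x ∈ (z , c) ∷ F.chain ⊎ x ∈ E₁ ++ F.below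
          split (here e) = inj₁ (here e)
          split (there i) with ∈-++⁻ E₁ i
          ... | inj₁ i∈E₁ = inj₂ (∈-++⁺ˡ i∈E₁)
          ... | inj₂ i∈E = [ inj₁ ∘ there , inj₂ ∘ ∈-++⁺ʳ E₁ ]′ (F.split i∈E)

          slot : ∀ j → Slot b j (lo j) (hi j) ((z , c) ∷ F.chain) (E₁ ++ F.below)
          slot j with b Fin.≟ j
          ... | no b≢j = off-axis-slot b≢j (lo≺z j ⟫ z≺u j) (u≺h j)
            (λ i → [ (λ i → F₁.≺t i j ⟫ t₁≺t j ⟫ t≺z j ⟫ z≺u j)
                   , (λ i → S.below≺t j i ⟫ t≺z j ⟫ z≺u j) ]′ (∈-++⁻ E₁ i))
            (λ i → E′≺u (chain⊆ i) j)
          ... | yes refl = record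
            { l≺g = S.l≺g b ⟫ S₁.l≺g b ⟫ S₁.g≺g′ b ⟫ S₁.g′≺t b
            ; g≺g′ = S₁.t≺h b
            ; g′≺t = S.g′≺t b ⟫ t≺z b ⟫ z≺u b
            ; t≺h = u≺h b
            ; below≺g = λ i → [ (λ i → F₁.≺t i b)
                              , (λ i → S.below≺g b i ⟫ S₁.l≺g b ⟫ S₁.g≺g′ b ⟫ S₁.g′≺t b) ]′ (∈-++⁻ E₁ i)
            ; chain≺t = λ i → E′≺u (chain⊆ i) b
            ; g′≺chain = λ { _ (here refl) → S.g′≺t b ⟫ t≺z b
                           ; _ (there i) → S.g′≺chain b refl i }
            ; chain≺g = contradiction refl
            }

    -- The fuel `f` bounds the number of colours that the chain on `L_b` still lacks to reach `T`. A
    -- round either gives the chain on `L_a` its last colour and ends the loop, or lengthens the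
    -- chain on `L_b` and lowers `f`.
    extend : ∀ {a b k} → a ≢ b → Strategy a k → Strategy a (suc k)
    extend {a} {b} {k} a≢b strategy {s} {lo} {hi} lo≺hi free budget win =
      loop T [] (nothing-forced b lo≺hi) (Width-mono z≤n Width-[]) (ℕ.m≤m+n T 0)
      where
      loop : ∀ f E (F : Forced b lo hi E) → Width (suc k) E →
             T ≤ f + length (Forced.chain F) → Wins (E ++ s)
      loop zero E F _ T≤ = wins-done chain (∈-++⁺ˡ ∘ chain⊆) chain-unique T≤
        where open Forced F
      loop (suc f) E F WE T≤ = strategy (λ j → Slot.g≺g′ (Forced.slot F j))
        (Forced.gap-free F free) (Forced.gap-budget F budget WE) λ E₁ F₁ WE₁ len₁ →
          subst Wins (List.++-assoc E₁ E s) (round E₁ F₁ WE₁ len₁)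
        where
        round : ∀ E₁ (F₁ : Forced a (Forced.g F) (Forced.g′ F) E₁) → Width k E₁ →
                length (Forced.chain F₁) ≡ k → Wins ((E₁ ++ E) ++ s)
        round E₁ F₁ WE₁ len₁ = wins-move z fresh (λ c → budget (E′ c) (E′⊆box c) (WE′ c)) answer
          where
          open Round a≢b F F₁

          WE′ : ∀ c → Width (suc k) (E′ c)
          WE′ c = Width-∷ c (s≤s z≤n) (λ i → i) (F.gap-width WE F₁.inBox WE₁)

          E′⊆box : ∀ c {x} → x ∈ E′ c → InBox lo hi x
          E′⊆box c i j = lo≺E′ c i j , E′≺u c i j ⟫ u≺h j

          z≢ : ∀ {q} j → z j ≺ q ⊎ q ≺ z j → z j ≢ q
          z≢ j (inj₁ z≺q) refl = ≺-irrefl z≺q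
          z≢ j (inj₂ q≺z) refl = ≺-irrefl q≺z

          fresh : Fresh z ((E₁ ++ E) ++ s)
          fresh i j with ∈-++⁻ (E₁ ++ E) i
          ... | inj₁ older = z≢ j (inj₂ (older≺z older j))
          ... | inj₂ i∈s = z≢ j (swap ([ (λ x≺l → inj₁ (x≺l ⟫ lo≺z j))
                                       , (λ h≺x → inj₂ (z≺u j ⟫ u≺h j ⟫ h≺x)) ]′ (free i∈s j)))

          answer : ∀ c → Wins (E′ c ++ s)
          answer c with c ∈? map colour F₁.chain
          ... | no c∉ = win (E′ c) (extend-short c c∉) (WE′ c) (cong suc len₁)
          -- The points of one chain are incomparable to those of the other, so a colour of one is
          -- not a colour of the other.
          ... | yes c∈ = wins-proper λ proper →
            loop f (E′ c) (extend-long c (c∉ proper)) (WE′ c)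
              (subst (T ≤_) (sym (ℕ.+-suc f _)) T≤)
            where
            c∉ : Proper (E′ c ++ s) → c ∉ map colour F.chain
            c∉ proper c∈F with ∈-map⁻ colour c∈ | ∈-map⁻ colour c∈F
            ... | y , y∈F₁ , c≡y | x , x∈F , c≡x =
              F.chain≁gap {x} {y} (a≢b ∘ sym) x∈F (F₁.inBox (F₁.chain⊆ y∈F₁))
                (proper (there (∈-++⁺ˡ (∈-++⁺ˡ (F₁.chain⊆ y∈F₁))))
                        (there (∈-++⁺ˡ (∈-++⁺ʳ E₁ (F.chain⊆ x∈F))))
                        (trans (sym c≡y) c≡x))

    force-chain : ∀ {a b} → a ≢ b → ∀ k → Strategy a k
    force-chain {a} a≢b zero lo≺hi free budget win = win [] (nothing-forced a lo≺hi) Width-[] refl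
    force-chain a≢b (suc k) {s} = extend a≢b (force-chain a≢b k) {s}

-- Fans: pairwise incomparable chains, one for each order but `L_0`

-- The colours forced in total when the width available is n + e.
gain : (e : ℕ) .{{_ : NonZero e}} → ℕ → ℕ
gain e zero    = 0
gain e (suc n) = (suc n + (suc n ∸ suc n / e)) + gain e n

module Phases (e-1 w T : ℕ) where

  e d : ℕ
  e = suc e-1
  d = suc e

  open Play d w T

  crossing : ∀ x y i j → x ⟨ i ⟩ ℚ.< y ⟨ i ⟩ → y ⟨ j ⟩ ℚ.< x ⟨ j ⟩ → ¬ x ~ y
  crossing x y i j x<y y<x (inj₁ x≤y) = ℚ.<-irrefl refl (ℚ.<-≤-trans y<x (x≤y j))
  crossing x y i j x<y y<x (inj₂ y≤x) = ℚ.<-irrefl refl (ℚ.<-≤-trans x<y (y≤x i))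

  module Up = Climb ℚ._<_ ℚ.<-trans (ℚ.<-irrefl refl) ℚ.<-dense
    (λ x y x<y → inj₁ (λ j → ℚ.<⇒≤ (x<y j))) crossing

  >-dense : ∀ {p q} → p ℚ.> q → ∃ λ r → p ℚ.> r × r ℚ.> q
  >-dense q<p with ℚ.<-dense q<p
  ... | r , q<r , r<p = r , r<p , q<r

  module Down = Climb ℚ._>_ (λ q<p r<q → ℚ.<-trans r<q q<p) (ℚ.<-irrefl refl) >-dense
    (λ x y y<x → inj₂ (λ j → ℚ.<⇒≤ (y<x j))) (λ x y i j y<x x<y → crossing x y j i x<y y<x)

  open Up using (Corner; InBox; Free; Budget; _⟫_)

  Chain : Set
  Chain = Fin e × List (Point d)

  -- The shift by `suc` reserves `L_0` for the crown, the chain that is placed above the others.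
  axis : Chain → Fin d
  axis K = suc (proj₁ K)

  points : Chain → List (Point d)
  points = proj₂

  -- The analogue of `Slot` for several chains at once: one gap lies beside all of them, under the
  -- chain with axis `j` and above the others.
  record FanSlot (j : Fin d) (l h : ℚ) (chains : List Chain) (below : List (Point d)) : Set where
    field
      g g′ t  : ℚ
      l<g     : l ℚ.< g
      g<g′    : g ℚ.< g′
      g′<t    : g′ ℚ.< t
      t<h     : t ℚ.< h
      below<g : ∀ {x} → x ∈ below → x ⟨ j ⟩ ℚ.< g
      chain<t : ∀ {K} → K ∈ chains → ∀ {x} → x ∈ points K → x ⟨ j ⟩ ℚ.< t
      g′<chain : ∀ {K} → K ∈ chains → axis K ≡ j → ∀ {x} → x ∈ points K → g′ ℚ.< x ⟨ j ⟩
      chain<g  : ∀ {K} → K ∈ chains → axis K ≢ j → ∀ {x} → x ∈ points K → x ⟨ j ⟩ ℚ.< g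

  record Fan (n : ℕ) (lo hi : Corner) (E : List (Point d)) (chains : List Chain) : Set where
    field
      below   : List (Point d)
      chain⊆  : ∀ {K} → K ∈ chains → points K ⊆ E
      split   : ∀ {x} → x ∈ E → (∃ λ K → K ∈ chains × x ∈ points K) ⊎ x ∈ below
      slot    : ∀ j → FanSlot j (lo j) (hi j) chains below
      lo<     : ∀ {x} → x ∈ E → ∀ j → lo j ℚ.< x ⟨ j ⟩
      indices-unique : Unique (map proj₁ chains)
      chain-width    : ∀ {K} → K ∈ chains → Width 1 (points K)
      chain-unique   : ∀ {K} → K ∈ chains → Unique (map colour (points K))
      chain-length   : ∀ {K} → K ∈ chains → length (points K) ≡ n

    module S j = FanSlot (slot j)

    g g′ t : Corner
    g  = S.g
    g′ = S.g′
    t  = S.t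

    <t : ∀ {x} → x ∈ E → ∀ j → x ⟨ j ⟩ ℚ.< t j
    <t i j with split i
    ... | inj₁ (K , K∈ , x∈K) = S.chain<t j K∈ x∈K
    ... | inj₂ x∈below = S.below<g j x∈below ⟫ S.g<g′ j ⟫ S.g′<t j

    inBox : ∀ {x} → x ∈ E → InBox lo hi x
    inBox i j = lo< i j , <t i j ⟫ S.t<h j

    gap-free : ∀ {s} → Free lo hi s → Free g g′ (E ++ s)
    gap-free free i j with ∈-++⁻ E i
    ... | inj₂ i∈s = [ (λ x<l → inj₁ (x<l ⟫ S.l<g j))
                     , (λ h<x → inj₂ (S.g′<t j ⟫ S.t<h j ⟫ h<x)) ]′ (free i∈s j)
    ... | inj₁ i∈E with split i∈E
    ...   | inj₂ x∈below = inj₁ (S.below<g j x∈below)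
    ...   | inj₁ (K , K∈ , x∈K) with axis K Fin.≟ j
    ...     | yes eq = inj₂ (S.g′<chain j K∈ eq x∈K)
    ...     | no neq = inj₁ (S.chain<g j K∈ neq x∈K)

    gap⊆box : ∀ {x} → InBox g g′ x → InBox lo hi x
    gap⊆box x∈gap j = S.l<g j ⟫ proj₁ (x∈gap j) , proj₂ (x∈gap j) ⟫ S.g′<t j ⟫ S.t<h j

    chains-width : Width (length chains) (concat (map points chains))
    chains-width = go chains chain-width
      where
      go : ∀ Ks → (∀ {K} → K ∈ Ks → Width 1 (points K)) → Width (length Ks) (concat (map points Ks))
      go [] _ = Width-[]
      go (K ∷ Ks) W = Width-++ (concat (map points Ks)) (Width-mono (ℕ.n≤1+n _) WKs) (W (here refl)) WKs
        (ℕ.≤-reflexive (ℕ.+-comm (length Ks) 1)) inj₁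
        where WKs = go Ks (W ∘ there)

    gap-width : ∀ {m k E′} → Width k E → length chains + m ≤ k →
                (∀ {x} → x ∈ E′ → InBox g g′ x) → Width m E′ → Width k (E′ ++ E)
    gap-width WE c+m≤k E′⊆gap WE′ = Width-++ (concat (map points chains)) WE WE′ chains-width c+m≤k meet
      where
      meet : ∀ {x} → x ∈ E → x ∈ concat (map points chains) ⊎ (∀ {y} → y ∈ _ → y ~ x)
      meet x∈E with split x∈E
      ... | inj₁ (K , K∈ , x∈K) = inj₁ (∈-concat⁺′ x∈K (∈-map⁺ points K∈))
      ... | inj₂ x∈below = inj₂ λ y∈E′ →
        inj₂ (λ j → ℚ.<⇒≤ (S.below<g j x∈below ⟫ proj₁ (E′⊆gap y∈E′ j)))

    gap-budget : ∀ {m k s} → Budget lo hi k s → Width k E → length chains + m ≤ k →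
                 Budget g g′ m (E ++ s)
    gap-budget {s = s} budget WE c+m≤k E′ E′⊆gap WE′ = subst (Width w) (List.++-assoc E′ E s)
      (budget (E′ ++ E)
        (λ {x} i → [ (λ i′ → gap⊆box {x} (E′⊆gap i′)) , inBox ]′ (∈-++⁻ E′ i))
        (gap-width WE c+m≤k E′⊆gap WE′))

    -- The common gap separates two chains: on the axis of either, that chain is above the gap and
    -- the other one is below it.
    chains-cross : ∀ {K K′ x y} → K ∈ chains → K′ ∈ chains → proj₁ K ≢ proj₁ K′ →
                   x ∈ points K → y ∈ points K′ → ¬ x ~ y
    chains-cross {K} {K′} {x} {y} K∈ K′∈ K≢K′ x∈K y∈K′ = crossing x y (axis K′) (axis K)
      (S.chain<g _ K∈ (K≢K′ ∘ Fin.suc-injective) x∈K ⟫ S.g<g′ _ ⟫ S.g′<chain _ K′∈ refl y∈K′)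
      (S.chain<g _ K′∈ (K≢K′ ∘ sym ∘ Fin.suc-injective) y∈K′ ⟫ S.g<g′ _ ⟫ S.g′<chain _ K∈ refl x∈K)

  empty-fan : ∀ {n lo hi} → (∀ j → lo j ℚ.< hi j) → Fan n lo hi [] []
  empty-fan {n} {lo} {hi} lo<hi = record
    { below = [] ; chain⊆ = λ () ; split = λ () ; slot = slot ; lo< = λ () ; indices-unique = []
    ; chain-width = λ () ; chain-unique = λ () ; chain-length = λ () }
    where
    slot : ∀ j → FanSlot j (lo j) (hi j) [] []
    slot j = record
      { l<g = S.l≺g ; g<g′ = S.g≺g′ ; g′<t = S.g′≺t ; t<h = S.t≺h
      ; below<g = λ () ; chain<t = λ () ; g′<chain = λ () ; chain<g = λ () }
      where module S = Up.Slot (Up.Forced.slot (Up.nothing-forced zero lo<hi) j)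

  -- The new chain is forced inside the gap of the fan. On its own axis the gap it leaves becomes
  -- the gap of the fan; elsewhere the gap shrinks to the part above `F.t`, which stays below any
  -- older chain with that axis.
  extend-fan : ∀ {n lo hi E E₁ Ks r} (R : Fan n lo hi E Ks) → r ∉ map proj₁ Ks →
    (F : Up.Forced (suc r) (Fan.g R) (Fan.g′ R) E₁) → length (Up.Forced.chain F) ≡ n →
    Fan n lo hi (E₁ ++ E) ((r , Up.Forced.chain F) ∷ Ks)
  extend-fan {n} {lo} {hi} {E} {E₁} {Ks} {r} R r∉ F len = record
    { below = F.below ++ R.below
    ; chain⊆ = λ { (here refl) → ∈-++⁺ˡ ∘ F.chain⊆ ; (there K∈) → ∈-++⁺ʳ E₁ ∘ R.chain⊆ K∈ }
    ; split = split
    ; slot = slot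
    ; lo< = λ i j → [ (λ i → R.S.l<g j ⟫ F.lo≺ i j) , (λ i → R.lo< i j) ]′ (∈-++⁻ E₁ i)
    ; indices-unique = All.tabulate (λ i r≡ → r∉ (subst (_∈ _) (sym r≡) i)) ∷ R.indices-unique
    ; chain-width = λ { (here refl) → F.chain-width ; (there K∈) → R.chain-width K∈ }
    ; chain-unique = λ { (here refl) → F.chain-unique ; (there K∈) → R.chain-unique K∈ }
    ; chain-length = λ { (here refl) → len ; (there K∈) → R.chain-length K∈ }
    }
    where
    module R = Fan R
    module F = Up.Forced F
    module S₁ j = Up.Slot (F.slot j)

    Ks′ = (r , F.chain) ∷ Ks

    split : ∀ {x} → x ∈ E₁ ++ E → (∃ λ K → K ∈ Ks′ × x ∈ points K) ⊎ x ∈ F.below ++ R.below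
    split i with ∈-++⁻ E₁ i
    ... | inj₁ i∈E₁ = [ (λ c → inj₁ (_ , here refl , c)) , inj₂ ∘ ∈-++⁺ˡ ]′ (F.split i∈E₁)
    ... | inj₂ i∈E = [ (λ { (K , K∈ , c) → inj₁ (K , there K∈ , c) })
                     , inj₂ ∘ ∈-++⁺ʳ F.below ]′ (R.split i∈E)

    r≢ : ∀ {K} → K ∈ Ks → axis K ≢ suc r
    r≢ K∈ eq = r∉ (subst (_∈ map proj₁ Ks) (Fin.suc-injective eq) (∈-map⁺ proj₁ K∈))

    slot : ∀ j → FanSlot j (lo j) (hi j) Ks′ (F.below ++ R.below)
    slot j with suc r Fin.≟ j
    ... | yes refl = record
      { l<g = R.S.l<g _ ⟫ S₁.l≺g _
      ; g<g′ = S₁.g≺g′ _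
      ; g′<t = S₁.g′≺t _ ⟫ S₁.t≺h _ ⟫ R.S.g′<t _
      ; t<h = R.S.t<h _
      ; below<g = λ i → [ S₁.below≺g _ , (λ i → R.S.below<g _ i ⟫ S₁.l≺g _) ]′ (∈-++⁻ F.below i)
      ; chain<t = λ { (here refl) i → S₁.chain≺t _ i ⟫ S₁.t≺h _ ⟫ R.S.g′<t _
                    ; (there K∈) → R.S.chain<t _ K∈ }
      ; g′<chain = λ { (here refl) _ → S₁.g′≺chain _ refl
                     ; (there K∈) eq → contradiction eq (r≢ K∈) }
      ; chain<g = λ { (here refl) neq → contradiction refl neq
                    ; (there K∈) neq i → R.S.chain<g _ K∈ neq i ⟫ S₁.l≺g _ }
      }
    ... | no r≢j = record
      { l<g = R.S.l<g j ⟫ g<t₁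
      ; g<g′ = S₁.t≺h j
      ; g′<t = R.S.g′<t j
      ; t<h = R.S.t<h j
      ; below<g = λ i → [ S₁.below≺t j , (λ i → R.S.below<g j i ⟫ g<t₁) ]′ (∈-++⁻ F.below i)
      ; chain<t = λ { (here refl) i → S₁.chain≺t j i ⟫ S₁.t≺h j ⟫ R.S.g′<t j
                    ; (there K∈) → R.S.chain<t j K∈ }
      ; g′<chain = λ { (here refl) eq → contradiction eq r≢j
                     ; (there K∈) → R.S.g′<chain j K∈ }
      ; chain<g = λ { (here refl) _ → S₁.chain≺t j
                    ; (there K∈) neq i → R.S.chain<g j K∈ neq i ⟫ g<t₁ }
      }
      where
      g<t₁ : R.g j ℚ.< F.t j
      g<t₁ = S₁.l≺g j ⟫ S₁.g≺g′ j ⟫ S₁.g′≺t j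

  -- The chains already there occupy at most `e` units of width, so the surplus `e` always leaves
  -- `n` units for the next one.
  force-fan : ∀ {n s lo hi} → (∀ j → lo j ℚ.< hi j) → Free lo hi s → Budget lo hi (n + e) s →
    (∀ E Ks → Fan n lo hi E Ks → Width (n + e) E → length Ks ≡ e → Wins (E ++ s)) → Wins s
  force-fan {n} {s} {lo} {hi} lo<hi free budget win =
    go (allFin e) (Unique.allFin⁺ e) (All.universal (λ _ ()) _)
      (trans (ℕ.+-identityʳ _) (List.length-tabulate {n = e} (λ i → i)))
      (empty-fan lo<hi) (Width-mono z≤n Width-[])
    where
    go : ∀ rs {E Ks} → Unique rs → All (_∉ map proj₁ Ks) rs → length rs + length Ks ≡ e →
         Fan n lo hi E Ks → Width (n + e) E → Wins (E ++ s)
    go [] _ _ len R WE = win _ _ R WE len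
    go (r ∷ rs) {E} {Ks} (r∉rs ∷ urs) (r∉ ∷ rs∉) len R WE =
      Up.force-chain {suc r} {zero} (λ ()) n (λ j → FanSlot.g<g′ (Fan.slot R j))
        (Fan.gap-free R free) (Fan.gap-budget R budget WE Ks+n≤) λ E₁ F WE₁ len₁ →
          subst Wins (List.++-assoc E₁ E s)
            (go rs urs
              (All.tabulate λ { r′∈ (here refl) → All.lookup r∉rs r′∈ refl
                              ; r′∈ (there r′∈Ks) → All.lookup rs∉ r′∈ r′∈Ks })
              (trans (ℕ.+-suc (length rs) _) len)
              (extend-fan R r∉ F len₁)
              (Fan.gap-width R WE Ks+n≤ (Up.Forced.inBox F) WE₁))
      where
      Ks+n≤ : length Ks + n ≤ n + e
      Ks+n≤ = ℕ.≤-trans (ℕ.≤-reflexive (ℕ.+-comm _ n))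
        (ℕ.+-monoʳ-≤ n (ℕ.m+n≤o⇒n≤o (suc (length rs)) (ℕ.≤-reflexive len)))

  -- A crown above the fan, and the harvest of a phase

  -- What later phases need to know. `separated` keeps the harvested colours out of all later play
  -- in the smaller box, and `gap-budget` says that they cost a single unit of width, as `n + e` is
  -- one more than `n + e-1`.
  record Phase (n : ℕ) (lo hi : Corner) (E : List (Point d)) : Set where
    field
      lo′ hi′    : Corner
      harvest    : List (Point d)
      lo′<hi′    : ∀ j → lo′ j ℚ.< hi′ j
      harvest⊆   : harvest ⊆ E
      unique     : Unique (map colour harvest)
      size       : n + (n ∸ n / e) ≤ length harvest
      inBox      : ∀ {x} → x ∈ E → InBox lo hi x
      gap⊆box    : ∀ {x} → InBox lo′ hi′ x → InBox lo hi x
      separated  : ∀ {x y} → x ∈ harvest → InBox lo′ hi′ y → ¬ y ~ x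
      gap-free   : ∀ {s} → Free lo hi s → Free lo′ hi′ (E ++ s)
      gap-budget : ∀ {s} → Budget lo hi (n + e) s → Budget lo′ hi′ (n + e-1) (E ++ s)

  indices-injective : ∀ {Ks : List Chain} → Unique (map proj₁ Ks) →
    ∀ {K K′} → K ∈ Ks → K′ ∈ Ks → proj₁ K ≡ proj₁ K′ → K ≡ K′
  indices-injective _        (here refl) (here refl) _  = refl
  indices-injective (k ∷ _)  (here refl) (there K′∈) eq =
    contradiction eq (All.lookup k (∈-map⁺ proj₁ K′∈))
  indices-injective (k ∷ _)  (there K∈)  (here refl) eq =
    contradiction (sym eq) (All.lookup k (∈-map⁺ proj₁ K∈))
  indices-injective (_ ∷ ks) (there K∈)  (there K′∈) eq = indices-injective ks K∈ K′∈ eq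

  coloured-like? : ∀ (K : Chain) → Decidable (λ (z : Point d) → colour z ∈ map colour (points K))
  coloured-like? K z = colour z ∈? map colour (points K)

  shared : List (Point d) → Chain → ℕ
  shared Z K = length (filter (coloured-like? K) Z)

  -- The next box lies in the gap of K in L_{axis K}, in the gap of the crown in L_0, and between
  -- the fan and the crown in the other orders.
  module Crown {n lo hi E E₁ Ks} (R : Fan n lo hi E Ks) (D : Down.Forced zero hi (Fan.t R) E₁)
    {K} (K∈ : K ∈ Ks) where

    module R = Fan R
    -- `D` comes from `Down`, so its inequalities are reversed: `D.g′` is the smaller end of its
    -- gap, `D.t` bounds `E₁` from below, and `D.below` lies above the gap.
    module D = Down.Forced D
    module S₁ j = Down.Slot (D.slot j)

    -- In every order other than `L_axis K` the new box starts at `R.t` or higher, hence above the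
    -- whole fan. So a fan point with this property is below the new box in all orders.
    Off : Point d → Set
    Off x = x ⟨ axis K ⟩ ℚ.< R.g (axis K)

    split-fan : ∀ {x} → x ∈ E → x ∈ points K ⊎ Off x
    split-fan x∈E with R.split x∈E
    ... | inj₂ x∈below = inj₂ (R.S.below<g _ x∈below)
    ... | inj₁ (K′ , K′∈ , x∈K′) with proj₁ K′ Fin.≟ proj₁ K
    ...   | yes eq = inj₁ (subst (λ K → _ ∈ points K) (indices-injective R.indices-unique K′∈ K∈ eq) x∈K′)
    ...   | no neq = inj₂ (R.S.chain<g _ K′∈ (neq ∘ Fin.suc-injective) x∈K′)

    record GapSlot (j : Fin d) : Set where
      field
        lo′ hi′   : ℚ
        lo<lo′    : lo j ℚ.< lo′
        lo′<hi′   : lo′ ℚ.< hi′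
        hi′<hi    : hi′ ℚ.< hi j
        off<lo′   : ∀ {x} → x ∈ E → Off x → x ⟨ j ⟩ ℚ.< lo′
        K<lo′     : axis K ≢ j → ∀ {x} → x ∈ points K → x ⟨ j ⟩ ℚ.< lo′
        hi′<K     : axis K ≡ j → ∀ {x} → x ∈ points K → hi′ ℚ.< x ⟨ j ⟩
        crown<lo′ : zero ≡ j → ∀ {x} → x ∈ D.chain → x ⟨ j ⟩ ℚ.< lo′
        hi′<crown : zero ≢ j → ∀ {x} → x ∈ D.chain → hi′ ℚ.< x ⟨ j ⟩
        hi′<above : ∀ {x} → x ∈ D.below → hi′ ℚ.< x ⟨ j ⟩

    lo<t : ∀ j → lo j ℚ.< R.t j
    lo<t j = R.S.l<g j ⟫ R.S.g<g′ j ⟫ R.S.g′<t j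

    gap-slot : ∀ j → GapSlot j
    gap-slot zero = record
      { lo<lo′ = lo<t zero ⟫ t<g′
      ; lo′<hi′ = S₁.g≺g′ zero
      ; hi′<hi = S₁.l≺g zero
      ; off<lo′ = λ i _ → R.<t i zero ⟫ t<g′
      ; K<lo′ = λ _ i → R.<t (R.chain⊆ K∈ i) zero ⟫ t<g′
      ; hi′<K = λ ()
      ; crown<lo′ = S₁.g′≺chain zero
      ; hi′<crown = contradiction refl
      ; hi′<above = S₁.below≺g zero
      }
      where
      t<g′ : R.t zero ℚ.< D.g′ zero
      t<g′ = S₁.t≺h zero ⟫ S₁.g′≺t zero
    gap-slot (suc j) with axis K Fin.≟ suc j
    ... | yes refl = record
      { lo<lo′ = R.S.l<g _
      ; lo′<hi′ = R.S.g<g′ _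
      ; hi′<hi = R.S.g′<t _ ⟫ R.S.t<h _
      ; off<lo′ = λ _ off → off
      ; K<lo′ = contradiction refl
      ; hi′<K = λ _ → R.S.g′<chain _ K∈ refl
      ; crown<lo′ = λ ()
      ; hi′<crown = λ _ i → g′<crown (D.chain⊆ i)
      ; hi′<above = λ i → g′<t₁ ⟫ S₁.below≺t _ i
      }
      where
      g′<t₁ : R.g′ (suc j) ℚ.< D.t (suc j)
      g′<t₁ = R.S.g′<t _ ⟫ S₁.t≺h _
      g′<crown : ∀ {x} → x ∈ E₁ → R.g′ (suc j) ℚ.< x ⟨ suc j ⟩
      g′<crown i = g′<t₁ ⟫ D.≺t i _
    ... | no K≢j = record
      { lo<lo′ = lo<t _
      ; lo′<hi′ = S₁.t≺h _
      ; hi′<hi = S₁.g′≺t _ ⟫ S₁.g≺g′ _ ⟫ S₁.l≺g _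
      ; off<lo′ = λ i _ → R.<t i _
      ; K<lo′ = λ _ i → R.<t (R.chain⊆ K∈ i) _
      ; hi′<K = λ eq → contradiction eq K≢j
      ; crown<lo′ = λ ()
      ; hi′<crown = λ _ i → D.≺t (D.chain⊆ i) _
      ; hi′<above = λ i → S₁.below≺t _ i
      }

    module G j = GapSlot (gap-slot j)

    fan<crown : ∀ {x y} → x ∈ E → y ∈ E₁ → ∀ j → x ⟨ j ⟩ ℚ.< y ⟨ j ⟩
    fan<crown x∈E y∈E₁ j = R.<t x∈E j ⟫ S₁.t≺h j ⟫ D.≺t y∈E₁ j

    fan-crown-comparable : ∀ {x} → x ∈ E → ∀ {y} → y ∈ E₁ → y ~ x
    fan-crown-comparable x∈E y∈E₁ = inj₂ (λ j → ℚ.<⇒≤ (fan<crown x∈E y∈E₁ j))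

    inBox : ∀ {x} → x ∈ E₁ ++ E → InBox lo hi x
    inBox i with ∈-++⁻ E₁ i
    ... | inj₁ i∈E₁ = λ j → lo<t j ⟫ S₁.t≺h j ⟫ D.≺t i∈E₁ j , D.lo≺ i∈E₁ j
    ... | inj₂ i∈E = R.inBox i∈E

    gap⊆box : ∀ {x} → InBox G.lo′ G.hi′ x → InBox lo hi x
    gap⊆box i j = G.lo<lo′ j ⟫ proj₁ (i j) , proj₂ (i j) ⟫ G.hi′<hi j

    beside : List (Point d)
    beside = D.chain ++ points K

    -- The new box lies below both `K` and the crown in `L_axis K`, and above both in `L_0`.
    beside-separated : ∀ {x y} → x ∈ beside → InBox G.lo′ G.hi′ y → ¬ y ~ x
    beside-separated {x} {y} i y∈gap with ∈-++⁻ D.chain i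
    ... | inj₁ x∈Z = crossing y x (axis K) zero
      (proj₂ (y∈gap _) ⟫ G.hi′<crown (axis K) (λ ()) x∈Z) (G.crown<lo′ zero refl x∈Z ⟫ proj₁ (y∈gap _))
    ... | inj₂ x∈K = crossing y x (axis K) zero
      (proj₂ (y∈gap _) ⟫ G.hi′<K (axis K) refl x∈K) (G.K<lo′ zero (λ ()) x∈K ⟫ proj₁ (y∈gap _))

    -- This is the saving: the fan lies below the crown, so `K` and the crown together cost the
    -- width of one chain.
    beside-width : Width 1 beside
    beside-width = Width-++-comparable (R.chain-width K∈) D.chain-width ℕ.≤-refl
      (λ x∈K y∈Z → fan-crown-comparable (R.chain⊆ K∈ x∈K) (D.chain⊆ y∈Z))

    gap-free : ∀ {s} → Free lo hi s → Free G.lo′ G.hi′ ((E₁ ++ E) ++ s)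
    gap-free free i j with ∈-++⁻ (E₁ ++ E) i
    ... | inj₂ x∈s = [ (λ x<l → inj₁ (x<l ⟫ G.lo<lo′ j)) , (λ h<x → inj₂ (G.hi′<hi j ⟫ h<x)) ]′ (free x∈s j)
    ... | inj₁ x∈ with ∈-++⁻ E₁ x∈
    ...   | inj₁ x∈E₁ with D.split x∈E₁ | zero Fin.≟ j
    ...     | inj₂ above | _      = inj₂ (G.hi′<above j above)
    ...     | inj₁ x∈Z   | yes eq = inj₁ (G.crown<lo′ j eq x∈Z)
    ...     | inj₁ x∈Z   | no neq = inj₂ (G.hi′<crown j neq x∈Z)
    gap-free free i j | inj₁ x∈ | inj₂ x∈E with split-fan x∈E | axis K Fin.≟ j
    ...     | inj₂ off | _      = inj₁ (G.off<lo′ j x∈E off)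
    ...     | inj₁ x∈K | yes eq = inj₂ (G.hi′<K j eq x∈K)
    ...     | inj₁ x∈K | no neq = inj₁ (G.K<lo′ j neq x∈K)

    -- The other chains of the fan stop costing width: in `L_axis K` they are below the gap, and so
    -- they are below the new box in every order.
    beside-or-comparable : ∀ {x} → x ∈ E₁ ++ E → x ∈ beside ⊎ (∀ y → InBox G.lo′ G.hi′ y → y ~ x)
    beside-or-comparable i with ∈-++⁻ E₁ i
    ... | inj₁ x∈E₁ = [ inj₁ ∘ ∈-++⁺ˡ
                      , (λ above → inj₂ λ y y∈gap →
                          inj₁ (λ j → ℚ.<⇒≤ (proj₂ (y∈gap j) ⟫ G.hi′<above j above))) ]′ (D.split x∈E₁)
    ... | inj₂ x∈E = [ inj₁ ∘ ∈-++⁺ʳ D.chain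
                     , (λ off → inj₂ λ y y∈gap →
                          inj₂ (λ j → ℚ.<⇒≤ (G.off<lo′ j x∈E off ⟫ proj₁ (y∈gap j)))) ]′ (split-fan x∈E)

    gap-budget : ∀ {k s} → Width (suc k) (E₁ ++ E) → Budget lo hi (suc k) s →
                 Budget G.lo′ G.hi′ k ((E₁ ++ E) ++ s)
    gap-budget {s = s} WE budget E′ E′⊆gap WE′ = subst (Width w) (List.++-assoc E′ (E₁ ++ E) s)
      (budget (E′ ++ E₁ ++ E)
        (λ {x} i → [ (λ i′ → gap⊆box {x} (E′⊆gap i′)) , inBox ]′ (∈-++⁻ E′ i))
        (Width-++ beside WE WE′ beside-width ℕ.≤-refl
          (λ x∈ → [ inj₁ , (λ comp → inj₂ λ {y} y∈E′ → comp y (E′⊆gap y∈E′)) ]′ (beside-or-comparable x∈))))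

    new-colours : List (Point d)
    new-colours = filter (λ z → ¬? (coloured-like? K z)) D.chain

    harvest-unique : Unique (map colour (points K ++ new-colours))
    harvest-unique = subst Unique (sym (List.map-++ colour (points K) new-colours))
      (Unique.++⁺ (R.chain-unique K∈)
        (AllPairs.map⁺ (AllPairs.filter⁺ _ (AllPairs.map⁻ D.chain-unique)))
        λ (c∈K , c∈new) → let z , z∈ , c≡ = ∈-map⁻ colour c∈new in
          proj₂ (∈-filter⁻ (λ z → ¬? (coloured-like? K z)) {xs = D.chain} z∈) (subst (_∈ _) c≡ c∈K))

    harvest-size : e ℕ.* shared D.chain K ≤ n → length D.chain ≡ n →
                   n + (n ∸ n / e) ≤ length (points K ++ new-colours)
    harvest-size few len = begin
      n + (n ∸ n / e)                          ≤⟨ ℕ.+-monoʳ-≤ n (ℕ.∸-monoʳ-≤ n shared≤) ⟩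
      n + (n ∸ shared D.chain K)               ≡⟨ cong (λ l → n + l) (sym new≡) ⟩
      n + length new-colours                   ≡⟨ cong (_+ length new-colours) (R.chain-length K∈) ⟨
      length (points K) + length new-colours   ≡⟨ List.length-++ (points K) ⟨
      length (points K ++ new-colours)         ∎
      where
      open ℕ.≤-Reasoning
      m = shared D.chain K
      shared≤ : shared D.chain K ≤ n / e
      shared≤ = ℕ.≤-trans
        (ℕ.≤-reflexive (sym (trans (cong (_/ e) (ℕ.*-comm e m)) (ℕ.m*n/n≡m m e))))
        (ℕ./-monoˡ-≤ e few)
      new≡ : length new-colours ≡ n ∸ shared D.chain K
      new≡ = trans (sym (ℕ.m+n∸m≡n (shared D.chain K) _))
        (cong (_∸ shared D.chain K) (trans (length-filter-∁ (coloured-like? K) D.chain) len))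

    phase : Width (n + e) (E₁ ++ E) → e ℕ.* shared D.chain K ≤ n → length D.chain ≡ n →
            Phase n lo hi (E₁ ++ E)
    phase WE few len = record
      { lo′ = G.lo′ ; hi′ = G.hi′
      ; harvest = points K ++ new-colours
      ; lo′<hi′ = G.lo′<hi′
      ; harvest⊆ = λ i → [ ∈-++⁺ʳ E₁ ∘ R.chain⊆ K∈ , ∈-++⁺ˡ ∘ D.chain⊆ ∘ new⊆ ]′ (∈-++⁻ (points K) i)
      ; unique = harvest-unique
      ; size = harvest-size few len
      ; inBox = inBox
      ; gap⊆box = λ {x} → gap⊆box {x}
      ; separated = λ {x} {y} i → beside-separated {x} {y}
          ([ ∈-++⁺ʳ D.chain , ∈-++⁺ˡ ∘ new⊆ ]′ (∈-++⁻ (points K) i))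
      ; gap-free = gap-free
      ; gap-budget = λ {s} budget → gap-budget (subst (λ k → Width k (E₁ ++ E)) (ℕ.+-suc n e-1) WE)
          (subst (λ k → Budget lo hi k s) (ℕ.+-suc n e-1) budget)
      }
      where
      new⊆ : new-colours ⊆ D.chain
      new⊆ i = proj₁ (∈-filter⁻ (λ z → ¬? (coloured-like? K z)) i)

  -- The crown is played between `R.t` and `hi`, hence above the whole fan, so its width is not
  -- added to that of the fan. The chain `K` is chosen only once the crown is complete.
  play-phase : ∀ {n s lo hi} → (∀ j → lo j ℚ.< hi j) → Free lo hi s → Budget lo hi (n + e) s →
    (∀ E → Phase n lo hi E → Wins (E ++ s)) → Wins s
  play-phase {n} {s} {lo} {hi} lo<hi free budget win =
    force-fan lo<hi free budget λ E Ks R WE lenKs →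
      Down.force-chain {zero} {suc zero} (λ ()) n (λ j → FanSlot.t<h (Fan.slot R j))
        (crown-free R) (crown-budget R WE) λ E₁ D WE₁ len →
          subst Wins (List.++-assoc E₁ E s)
            (wins-proper λ proper → win (E₁ ++ E) (best R D WE WE₁ len lenKs proper))
    where
    module _ {E Ks} (R : Fan n lo hi E Ks) where

      module R = Fan R

      crown-free : Down.Free hi R.t (E ++ s)
      crown-free i j with ∈-++⁻ E i
      ... | inj₁ x∈E = inj₂ (R.<t x∈E j)
      ... | inj₂ x∈s = [ (λ x<l → inj₂ (x<l ⟫ R.S.l<g j ⟫ R.S.g<g′ j ⟫ R.S.g′<t j)) , inj₁ ]′ (free x∈s j)

      above-width : ∀ {E₁} → Width (n + e) E → (∀ {x} → x ∈ E₁ → Down.InBox hi R.t x) →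
                    Width n E₁ → Width (n + e) (E₁ ++ E)
      above-width WE E₁⊆ WE₁ = Width-++-comparable WE WE₁ (ℕ.m≤m+n n e)
        (λ x∈E y∈E₁ → inj₂ (λ j → ℚ.<⇒≤ (R.<t x∈E j ⟫ proj₂ (E₁⊆ y∈E₁ j))))

      crown-budget : Width (n + e) E → Down.Budget hi R.t n (E ++ s)
      crown-budget WE E₁ E₁⊆ WE₁ = subst (Width w) (List.++-assoc E₁ E s)
        (budget (E₁ ++ E)
          (λ i → [ (λ i′ j → R.S.l<g j ⟫ R.S.g<g′ j ⟫ R.S.g′<t j ⟫ proj₂ (E₁⊆ i′ j) , proj₁ (E₁⊆ i′ j))
                 , R.inBox ]′ (∈-++⁻ E₁ i))
          (above-width WE E₁⊆ WE₁))

      -- Incomparable chains have disjoint colours, so the `e` overlaps with the crown add up to at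
      -- most `n`, and the smallest of them is at most the average.
      best : ∀ {E₁} (D : Down.Forced zero hi R.t E₁) → Width (n + e) E → Width n E₁ →
             length (Down.Forced.chain D) ≡ n → length Ks ≡ e → Proper ((E₁ ++ E) ++ s) →
             Phase n lo hi (E₁ ++ E)
      best {E₁} D WE WE₁ len lenKs proper
        with min≤average (shared D.chain) Ks (ℕ.≤-trans (s≤s z≤n) (ℕ.≤-reflexive (sym lenKs)))
        where module D = Down.Forced D
      ... | K , K∈ , le = Crown.phase R D K∈ (above-width WE D.inBox WE₁)
        (subst (λ l → l ℕ.* shared D.chain K ≤ n) lenKs
          (ℕ.≤-trans le (ℕ.≤-trans (disjoint-counts coloured-like? disjoint D.chain) (ℕ.≤-reflexive len))))
        len
        where
        module D = Down.Forced D
        disjoint : AllPairs (λ K K′ → ∀ {z} → colour z ∈ map colour (points K) →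
                                              ¬ colour z ∈ map colour (points K′)) Ks
        disjoint = go R.indices-unique (λ i → i)
          where
          go : ∀ {Ks′} → Unique (map proj₁ Ks′) → Ks′ ⊆ Ks → AllPairs _ Ks′
          go {[]} _ _ = []
          go {K ∷ Ks′} (k ∷ ks) sub = All.tabulate cross ∷ go ks (sub ∘ there)
            where
            cross : ∀ {K′} → K′ ∈ Ks′ → ∀ {z} → colour z ∈ map colour (points K) →
                    ¬ colour z ∈ map colour (points K′)
            cross K′∈ c∈K c∈K′ with ∈-map⁻ colour c∈K | ∈-map⁻ colour c∈K′
            ... | x , x∈K , c≡x | y , y∈K′ , c≡y =
              R.chains-cross (sub (here refl)) (sub (there K′∈)) (All.lookup k (∈-map⁺ proj₁ K′∈)) x∈K y∈K′
                (proper (∈-++⁺ˡ (∈-++⁺ʳ E₁ (R.chain⊆ (sub (here refl)) x∈K)))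
                        (∈-++⁺ˡ (∈-++⁺ʳ E₁ (R.chain⊆ (sub (there K′∈)) y∈K′)))
                        (trans (sym c≡x) c≡y))

  -- Accumulating colours over all phases

  -- `U` collects the harvests. Its points are incomparable to everything in the current box, so no
  -- colour of `U` can return, and each phase trades one unit of `n` for the next summand of `gain`.
  play-phases : ∀ n {s lo hi} U → (∀ j → lo j ℚ.< hi j) → Free lo hi s → Budget lo hi (n + e) s →
    U ⊆ s → Unique (map colour U) → (∀ {x y} → x ∈ U → InBox lo hi y → ¬ y ~ x) →
    T ≤ gain e n + length U → Wins s
  play-phases zero U _ _ _ U⊆s unique _ T≤ = wins-done U U⊆s unique T≤
  play-phases (suc n) {s} {lo} {hi} U lo<hi free budget U⊆s unique separated T≤ =
    play-phase lo<hi free budget λ E P → wins-proper λ proper →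
      let module P = Phase P
          disjoint : ∀ {c} → ¬ (c ∈ map colour P.harvest × c ∈ map colour U)
          disjoint (c∈V , c∈U) =
            let x , x∈V , c≡x = ∈-map⁻ colour c∈V
                y , y∈U , c≡y = ∈-map⁻ colour c∈U
            in separated {y} {x} y∈U (P.inBox (P.harvest⊆ x∈V))
                 (proper (∈-++⁺ˡ (P.harvest⊆ x∈V)) (∈-++⁺ʳ E (U⊆s y∈U)) (trans (sym c≡x) c≡y))
      in play-phases n (P.harvest ++ U) P.lo′<hi′ (P.gap-free free)
        (subst (λ k → Budget P.lo′ P.hi′ k (E ++ s)) (sym (ℕ.+-suc n e-1)) (P.gap-budget budget))
        (λ i → [ ∈-++⁺ˡ ∘ P.harvest⊆ , ∈-++⁺ʳ E ∘ U⊆s ]′ (∈-++⁻ P.harvest i))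
        (subst Unique (sym (List.map-++ colour P.harvest U)) (Unique.++⁺ P.unique unique disjoint))
        (λ {x} {y} i y∈gap → [ (λ x∈V → P.separated {x} {y} x∈V y∈gap)
                             , (λ x∈U → separated {x} {y} x∈U (P.gap⊆box {y} y∈gap)) ]′ (∈-++⁻ P.harvest i))
        (begin
          T                                                          ≤⟨ T≤ ⟩
          ((suc n + (suc n ∸ suc n / e)) + gain e n) + length U
            ≤⟨ ℕ.+-monoˡ-≤ (length U) (ℕ.+-monoˡ-≤ (gain e n) P.size) ⟩
          (length P.harvest + gain e n) + length U
            ≡⟨ cong (_+ length U) (ℕ.+-comm _ (gain e n)) ⟩
          (gain e n + length P.harvest) + length U                     ≡⟨ ℕ.+-assoc (gain e n) _ _ ⟩
          gain e n + (length P.harvest + length U)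
            ≡⟨ cong (λ l → gain e n + l) (List.length-++ P.harvest) ⟨
          gain e n + length (P.harvest ++ U)                           ∎)
    where open ℕ.≤-Reasoning

-- Triangular numbers and the growth of `gain`

triangle : ℕ → ℕ
triangle n = (n + 1) C 2

triangle-suc : ∀ n → triangle (suc n) ≡ suc n + triangle n
triangle-suc n = trans (sym (nCk+nC[k+1]≡[n+1]C[k+1] (n + 1) 1))
  (cong (_+ triangle n) (trans (nC1≡n (n + 1)) (ℕ.+-comm n 1)))

2*triangle : ∀ n → 2 ℕ.* triangle n ≡ n ℕ.* suc n
2*triangle zero = refl
2*triangle (suc n) = begin
  2 ℕ.* triangle (suc n)       ≡⟨ cong (2 ℕ.*_) (triangle-suc n) ⟩
  2 ℕ.* (suc n + triangle n)   ≡⟨ ℕ.*-distribˡ-+ 2 (suc n) (triangle n) ⟩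
  2 ℕ.* suc n + 2 ℕ.* triangle n ≡⟨ cong (λ t → 2 ℕ.* suc n + t) (2*triangle n) ⟩
  2 ℕ.* suc n + n ℕ.* suc n      ≡⟨ ℕ.*-distribʳ-+ (suc n) 2 n ⟨
  (2 + n) ℕ.* suc n            ≡⟨ ℕ.*-comm (2 + n) (suc n) ⟩
  suc n ℕ.* suc (suc n)        ∎
  where open ≡-Reasoning

triangle-mono : ∀ n m → triangle n ≤ triangle (n + m)
triangle-mono n zero = ℕ.≤-reflexive (cong triangle (sym (ℕ.+-identityʳ n)))
triangle-mono n (suc m) = begin
  triangle n                     ≤⟨ triangle-mono n m ⟩
  triangle (n + m)               ≤⟨ ℕ.m≤n+m _ (suc (n + m)) ⟩
  suc (n + m) + triangle (n + m) ≡⟨ triangle-suc (n + m) ⟨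
  triangle (suc (n + m))         ≡⟨ cong triangle (ℕ.+-suc n m) ⟨
  triangle (n + suc m)           ∎
  where open ℕ.≤-Reasoning

triangle-+ : ∀ n m → triangle (n + m) ≤ triangle n + m ℕ.* (n + m)
triangle-+ n zero = ℕ.≤-reflexive (trans (cong triangle (ℕ.+-identityʳ n)) (sym (ℕ.+-identityʳ _)))
triangle-+ n (suc m) = begin
  triangle (n + suc m)                          ≡⟨ cong triangle (ℕ.+-suc n m) ⟩
  triangle (suc (n + m))                        ≡⟨ triangle-suc (n + m) ⟩
  suc (n + m) + triangle (n + m)                ≤⟨ ℕ.+-monoʳ-≤ (suc (n + m)) (triangle-+ n m) ⟩
  suc (n + m) + (triangle n + m ℕ.* (n + m))
    ≤⟨ ℕ.+-monoʳ-≤ (suc (n + m)) (ℕ.+-monoʳ-≤ (triangle n) (ℕ.*-monoʳ-≤ m (ℕ.n≤1+n (n + m)))) ⟩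
  suc (n + m) + (triangle n + m ℕ.* suc (n + m))
    ≡⟨ solve 3 (λ s t m → s :+ (t :+ m :* s) :=
        t :+ (con 1 :+ m) :* s) refl (suc (n + m)) (triangle n) m ⟩
  triangle n + suc m ℕ.* suc (n + m)
    ≡⟨ cong (λ k → triangle n + suc m ℕ.* k) (ℕ.+-suc n m) ⟨
  triangle n + suc m ℕ.* (n + suc m)              ∎
  where
  open ℕ.≤-Reasoning
  open +-*-Solver

linear≤triangle : ∀ k n → 2 ℕ.* k ≤ n → k ℕ.* n ≤ triangle n
linear≤triangle k n 2k≤n = ℕ.*-cancelˡ-≤ 2 (begin
  2 ℕ.* (k ℕ.* n)    ≡⟨ ℕ.*-assoc 2 k n ⟨
  2 ℕ.* k ℕ.* n      ≤⟨ ℕ.*-monoˡ-≤ n 2k≤n ⟩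
  n ℕ.* n          ≤⟨ ℕ.*-monoʳ-≤ n (ℕ.n≤1+n n) ⟩
  n ℕ.* suc n      ≡⟨ 2*triangle n ⟨
  2 ℕ.* triangle n ∎)
  where open ℕ.≤-Reasoning

module _ (e-1 : ℕ) where

  private
    e = suc e-1

  -- This is `gain e n ≥ (2 - 1/e) * triangle n`, cleared of division and subtraction. Each summand
  -- of `gain` is large enough because `(n / e) * e ≤ n`.
  gain-lower-bound : ∀ n → 2 ℕ.* e ℕ.* triangle n ≤ e ℕ.* gain e n + triangle n
  gain-lower-bound zero =
    ℕ.≤-reflexive (trans (ℕ.*-zeroʳ (2 ℕ.* e)) (sym (trans (ℕ.+-identityʳ _) (ℕ.*-zeroʳ e))))
  gain-lower-bound (suc n′) = begin
    2 ℕ.* e ℕ.* triangle n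
      ≡⟨ cong (2 ℕ.* e ℕ.*_) (triangle-suc n′) ⟩
    2 ℕ.* e ℕ.* (n + t)
      ≡⟨ solve 3 (λ e n t → con 2 :* e :* (n :+ t) := e :* n :+ e :* n :+ con 2 :* e :* t) refl e n t ⟩
    e ℕ.* n + e ℕ.* n + 2 ℕ.* e ℕ.* t
      ≤⟨ ℕ.+-mono-≤ (ℕ.+-monoʳ-≤ (e ℕ.* n) e*n≤) (gain-lower-bound n′) ⟩
    e ℕ.* n + (e ℕ.* r + n) + (e ℕ.* gain e n′ + t)
      ≡⟨ solve 5 (λ e n r g t → e :* n :+ (e :* r :+ n) :+ (e :* g :+ t) :=
          e :* (n :+ r :+ g) :+ (n :+ t)) refl e n r (gain e n′) t ⟩
    e ℕ.* (n + r + gain e n′) + (n + t)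
      ≡⟨ cong (λ s → e ℕ.* (n + r + gain e n′) + s) (triangle-suc n′) ⟨
    e ℕ.* gain e n + triangle n                             ∎
    where
    open ℕ.≤-Reasoning
    open +-*-Solver
    n = suc n′
    t = triangle n′
    r = n ∸ n / e
    e*n≤ : e ℕ.* n ≤ e ℕ.* r + n
    e*n≤ = begin
      e ℕ.* n                   ≤⟨ ℕ.*-monoʳ-≤ e (ℕ.m≤n+m∸n n (n / e)) ⟩
      e ℕ.* (n / e + r)
        ≡⟨ solve 3 (λ e q r → e :* (q :+ r) := e :* r :+ q :* e) refl e (n / e) r ⟩
      e ℕ.* r + n / e ℕ.* e       ≤⟨ ℕ.+-monoʳ-≤ (e ℕ.* r) (ℕ.m/n*n≤m n e) ⟩
      e ℕ.* r + n               ∎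

  -- Here `ε = (p + 1) / M`. The width `e` set aside costs at most `e * w` in `triangle`, linear in
  -- `w = n + e`. Once `w` is at least `4 * e * M`, twice this cost is at most `triangle w / M`,
  -- which `ε` covers.
  gain-asymptotics : ∀ M p n → 2 ℕ.* (2 ℕ.* e ℕ.* M) ≤ n + e →
    2 ℕ.* e ℕ.* M ℕ.* triangle (n + e) ≤ e ℕ.* M ℕ.* gain e n + (M + suc p ℕ.* e) ℕ.* triangle (n + e)
  gain-asymptotics M p n large = begin
    2 ℕ.* e ℕ.* M ℕ.* A                          ≤⟨ ℕ.*-monoʳ-≤ (2 ℕ.* e ℕ.* M) (triangle-+ n e) ⟩
    2 ℕ.* e ℕ.* M ℕ.* (B + e ℕ.* w)
      ≡⟨ solve 4 (λ e M B w → con 2 :* e :* M :* (B :+ e :* w) :=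
          M :* (con 2 :* e :* B) :+ e :* (con 2 :* e :* M :* w)) refl e M B w ⟩
    M ℕ.* (2 ℕ.* e ℕ.* B) + e ℕ.* (2 ℕ.* e ℕ.* M ℕ.* w)
      ≤⟨ ℕ.+-mono-≤
        (ℕ.*-monoʳ-≤ M (ℕ.≤-trans (gain-lower-bound n) (ℕ.+-monoʳ-≤ (e ℕ.* G) (triangle-mono n e))))
        (ℕ.*-monoʳ-≤ e (linear≤triangle (2 ℕ.* e ℕ.* M) w large)) ⟩
    M ℕ.* (e ℕ.* G + A) + e ℕ.* A                ≤⟨ ℕ.m≤m+n _ (p ℕ.* e ℕ.* A) ⟩
    M ℕ.* (e ℕ.* G + A) + e ℕ.* A + p ℕ.* e ℕ.* A
      ≡⟨ solve 5 (λ e M G A p → M :* (e :* G :+ A) :+ e :* A :+ p :* e :* A :=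
          e :* M :* G :+ (M :+ (con 1 :+ p) :* e) :* A) refl e M G A p ⟩
    e ℕ.* M ℕ.* G + (M + suc p ℕ.* e) ℕ.* A        ∎
    where
    open ℕ.≤-Reasoning
    open +-*-Solver
    w = n + e
    A = triangle w
    B = triangle n
    G = gain e n

-- From natural numbers to the rational inequality

-- With ε = (p + 1) / M, the hypothesis is the conclusion with the denominators cleared and the
-- subtractions moved over.
cleared-bound : ∀ e-1 ε p M-1 A G → toℚᵘ ε ≡ mkℚᵘ +[1+ p ] M-1 →
  2 ℕ.* suc e-1 ℕ.* suc M-1 ℕ.* A ≤ suc e-1 ℕ.* suc M-1 ℕ.* G + (suc M-1 + suc p ℕ.* suc e-1) ℕ.* A →
  (ℕ→ℚ 2 ℚ.- oneOver (suc e-1) ℚ.- ε) ℚ.* ℕ→ℚ A ℚ.≤ ℕ→ℚ G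
cleared-bound e-1 ε p M-1 A G ε≡ le = ℚ.toℚᵘ-cancel-≤ (begin
  toℚᵘ ((ℕ→ℚ 2 ℚ.- oneOver e ℚ.- ε) ℚ.* ℕ→ℚ A)
    ≃⟨ ℚ.toℚᵘ-homo-* (ℕ→ℚ 2 ℚ.- oneOver e ℚ.- ε) (ℕ→ℚ A) ⟩
  toℚᵘ (ℕ→ℚ 2 ℚ.- oneOver e ℚ.- ε) ℚᵘ.* toℚᵘ (ℕ→ℚ A)
    ≃⟨ ℚᵘ.*-cong coefficient (ℚ.toℚᵘ-fromℚᵘ (mkℚᵘ (+ A) 0)) ⟩
  (mkℚᵘ (+ 2) 0 ℚᵘ.- mkℚᵘ (+ 1) e-1 ℚᵘ.- mkℚᵘ (+ suc p) M-1) ℚᵘ.* mkℚᵘ (+ A) 0 ≤⟨ *≤* integers ⟩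
  mkℚᵘ (+ G) 0                                                    ≃⟨ ℚ.toℚᵘ-fromℚᵘ (mkℚᵘ (+ G) 0) ⟨
  toℚᵘ (ℕ→ℚ G)                                                    ∎)
  where
  open ℚᵘ.≤-Reasoning
  e = suc e-1
  M = suc M-1

  toℚᵘ-homo-minus : ∀ p q → toℚᵘ (p ℚ.- q) ℚᵘ.≃ toℚᵘ p ℚᵘ.- toℚᵘ q
  toℚᵘ-homo-minus p q = ℚᵘ.≃-trans (ℚ.toℚᵘ-homo-+ p (ℚ.- q))
    (ℚᵘ.+-cong (ℚᵘ.≃-refl {toℚᵘ p}) (ℚ.toℚᵘ-homo‿- q))

  coefficient : toℚᵘ (ℕ→ℚ 2 ℚ.- oneOver e ℚ.- ε) ℚᵘ.≃
                mkℚᵘ (+ 2) 0 ℚᵘ.- mkℚᵘ (+ 1) e-1 ℚᵘ.- mkℚᵘ (+ suc p) M-1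
  coefficient = ℚᵘ.≃-trans (toℚᵘ-homo-minus (ℕ→ℚ 2 ℚ.- oneOver e) ε)
    (ℚᵘ.+-cong
      (ℚᵘ.≃-trans (toℚᵘ-homo-minus (ℕ→ℚ 2) (oneOver e))
        (ℚᵘ.+-cong (ℚ.toℚᵘ-fromℚᵘ (mkℚᵘ (+ 2) 0)) (ℚᵘ.-‿cong (ℚ.toℚᵘ-fromℚᵘ (mkℚᵘ (+ 1) e-1)))))
      (ℚᵘ.-‿cong (ℚᵘ.≃-reflexive ε≡)))

  cast : + 2 ℤ.* + e ℤ.* + M ℤ.* + A ℤ.≤ + e ℤ.* + M ℤ.* + G ℤ.+ (+ M ℤ.+ + suc p ℤ.* + e) ℤ.* + A
  cast = subst₂ ℤ._≤_ left right (ℤ.+≤+ le)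
    where
    left : + (2 ℕ.* e ℕ.* M ℕ.* A) ≡ + 2 ℤ.* + e ℤ.* + M ℤ.* + A
    left = trans (ℤ.pos-* (2 ℕ.* e ℕ.* M) A) (cong (ℤ._* + A)
      (trans (ℤ.pos-* (2 ℕ.* e) M) (cong (ℤ._* + M) (ℤ.pos-* 2 e))))
    right : + (e ℕ.* M ℕ.* G + (M + suc p ℕ.* e) ℕ.* A) ≡
            + e ℤ.* + M ℤ.* + G ℤ.+ (+ M ℤ.+ + suc p ℤ.* + e) ℤ.* + A
    right = trans (ℤ.pos-+ (e ℕ.* M ℕ.* G) _) (cong₂ ℤ._+_
      (trans (ℤ.pos-* (e ℕ.* M) G) (cong (ℤ._* + G) (ℤ.pos-* e M)))
      (trans (ℤ.pos-* (M + suc p ℕ.* e) A) (cong (ℤ._* + A)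
        (trans (ℤ.pos-+ M _) (cong (ℤ._+_ (+ M)) (ℤ.pos-* (suc p) e))))))

  X = (+ M ℤ.+ + suc p ℤ.* + e) ℤ.* + A

  -- The factors `1` are left by the way in which unnormalised sums, products and comparisons
  -- unfold.
  integers : ((((+ 2 ℤ.* + e ℤ.+ ℤ.- + 1 ℤ.* + 1) ℤ.* + M) ℤ.+ ℤ.- + suc p ℤ.* + (1 ℕ.* e)) ℤ.* + A) ℤ.* + 1
             ℤ.≤ + G ℤ.* + (1 ℕ.* e ℕ.* M ℕ.* 1)
  integers = subst₂ ℤ._≤_ left right (ℤ.+-monoˡ-≤ (ℤ.- X) cast)
    where
    open ℤ.+-*-Solver
    left : + 2 ℤ.* + e ℤ.* + M ℤ.* + A ℤ.- X ≡
           ((((+ 2 ℤ.* + e ℤ.+ ℤ.- + 1 ℤ.* + 1) ℤ.* + M) ℤ.+ ℤ.- + suc p ℤ.* + (1 ℕ.* e)) ℤ.* + A) ℤ.* + 1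
    left = trans (solve 4 (λ e M p A → con (+ 2) :* e :* M :* A :- (M :+ p :* e) :* A :=
        (((con (+ 2) :* e :+ con (ℤ.- + 1) :* con (+ 1)) :* M) :+ (:- p) :* e) :* A :* con (+ 1))
        refl (+ e) (+ M) (+ suc p) (+ A))
      (cong (λ k → ((((+ 2 ℤ.* + e ℤ.+ ℤ.- + 1 ℤ.* + 1) ℤ.* + M) ℤ.+ ℤ.- + suc p ℤ.* + k) ℤ.* + A) ℤ.* + 1)
        (sym (ℕ.*-identityˡ e)))
    right : + e ℤ.* + M ℤ.* + G ℤ.+ X ℤ.- X ≡ + G ℤ.* + (1 ℕ.* e ℕ.* M ℕ.* 1)
    right = trans (solve 4 (λ e M G X → e :* M :* G :+ X :- X := G :* (e :* M)) refl (+ e) (+ M) (+ G) X)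
      (cong (+ G ℤ.*_) (trans (sym (ℤ.pos-* e M))
        (cong +_ (sym (trans (ℕ.*-identityʳ _) (cong (ℕ._* M) (ℕ.*-identityˡ e)))))))

-- Play from the empty position, and the bound for large widths

olwR≥gain : ∀ e-1 N → OlwR≥ (N + suc e-1) (suc (suc e-1)) (gain (suc e-1) N)
-- The first box is the unit cube, still without points, and its budget is the whole width.
olwR≥gain e-1 N = play-phases N {lo = λ _ → 0ℚ} {hi = λ _ → 1ℚ} []
  (λ _ → ℚ.positive⁻¹ 1ℚ) (λ ())
  (λ E _ WE → subst (Width (N + suc e-1)) (sym (List.++-identityʳ E)) WE)
  (λ ()) [] (λ ()) (ℕ.≤-reflexive (sym (ℕ.+-identityʳ _)))
  record { coloured = λ () ; opened = λ () ; mono = λ _ () ; cancel = λ _ () ; proper = λ () }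
  where
  open Phases e-1 (N + suc e-1) (gain (suc e-1) N)
  open Play (suc (suc e-1)) (N + suc e-1) (gain (suc e-1) N)

theorem1p2 : (d : ℕ) → 2 ≤ d →
    (ε : ℚ) → 0ℚ < ε →
    Σ ℕ λ W → (w : ℕ) → 1 ≤ w → W ≤ w →
    Σ ℕ λ k → OlwR≥ w d k ×
    ((ℕ→ℚ 2 - oneOver (d ∸ 1) - ε) * ℕ→ℚ ((w + 1) C 2) ≤ℚ ℕ→ℚ k)
theorem1p2 (suc zero) (s≤s ())
theorem1p2 (suc (suc e-1)) _ (mkℚ (+ 0) _ _) (*<* (ℤ.+<+ ()))
-- The summand `4eM` makes the linear loss negligible against `ε`; the summand `e` makes `w ∸ e` a
-- true difference, so that `w` has the form `N + e`.
theorem1p2 (suc (suc e-1)) _ ε@(mkℚ +[1+ p ] M-1 _) _ = 4eM + e , λ w _ W≤w →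
  let w≡ = ℕ.m∸n+n≡m (ℕ.m+n≤o⇒n≤o 4eM W≤w)
  in subst Bound w≡ (bound (w ∸ e) (subst (4eM ≤_) (sym w≡) (ℕ.m+n≤o⇒m≤o 4eM W≤w)))
  where
  e 4eM : ℕ
  e = suc e-1
  4eM = 2 ℕ.* (2 ℕ.* e ℕ.* suc M-1)

  Bound : ℕ → Set
  Bound w = Σ ℕ λ k → OlwR≥ w (suc e) k ×
    ((ℕ→ℚ 2 - oneOver e - ε) * ℕ→ℚ (triangle w) ≤ℚ ℕ→ℚ k)

  bound : ∀ N → 4eM ≤ N + e → Bound (N + e)
  bound N large = gain e N , olwR≥gain e-1 N ,
    cleared-bound e-1 ε p M-1 (triangle (N + e)) (gain e N) refl (gain-asymptotics e-1 (suc M-1) p N large)
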